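{- Let $\mathcal{L}=\{l_1,\dots,l_s\}$ be a set of $s$ nonnegative integers with $l_{1} < l_{2} < \cdots <l_{s}$ and $\mathbb{F}_{q}$ be a finite field of order $q$. Suppose that $\mathcal{V} = \{V_{1}, \ldots, V_{m}\}$ is a collection of subspaces of an $n$-dimensional vector space over $\mathbb{F}_{q}$ such that $\mathrm{dim}(V_{i} \cap V_{j}) \in \mathcal{L}$ for any distinct $V_{i}, V_{j}\in\mathcal{V}$, and the dimension of every member of $\mathcal{V}$ belongs to $\{k_{1}, \ldots, k_{r}\}$ with $k_{i} > s - r + l_{1}$ for every $i$. Let $k = \max\{\dim(V_{j}) : 1 \le j \le m\}$. If $n \ge \log_{q}\big((q^{s} - 1)\binom{k^{2}}{l_{1} + 1}_{q} + 1\big) + l_{1}$, then \[ |\mathcal{V}| \le \binom{n - l_{1}}{s}_{q} + \binom{n - l_{1}}{s - 1}_{q} + \cdots + \binom{n - l_{1}}{s - r + 1}_{q}. \]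
   Context: Here $\binom{n}{k}_{q} := \prod_{0 \le i \leq k - 1} \frac{q^{n - i}-1}{q^{k - i}-1}$ denotes the Gaussian binomial coefficient, i.e. the number of $k$-dimensional subspaces of an $n$-dimensional vector space over $\mathbb{F}_q$; $q$ is a prime power. -}

module Defs where

open import Data.Nat using (ℕ; zero; suc; _+_; _*_; _∸_; _^_; _⊔_; _≤ᵇ_)
open import Data.Nat.DivMod using (_/_)
open import Data.Bool using (if_then_else_)
open import Data.Fin using (Fin)
import Data.Fin as Fin
open import Data.Vec using (Vec; zipWith; map; replicate)
open import Data.Product using (Σ; ∃; _×_; _,_)
open import Relation.Binary.PropositionalEquality using (_≡_; _≢_)
open import Relation.Nullary using (¬_)
open import Function.Bundles using (_↔_)
import Algebra.Structures as AS

record FiniteField (q : ℕ) : Set₁ where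
  field
    F : Set
    0# 1# : F
    _+F_ _*F_ : F → F → F
    -F_ : F → F
    isCommutativeRing : AS.IsCommutativeRing {A = F} _≡_ _+F_ _*F_ -F_ 0# 1#
    0≢1 : 0# ≢ 1#
    inverse : ∀ x → x ≢ 0# → ∃ λ y → (x *F y) ≡ 1#
    card : F ↔ Fin q

module _ {q : ℕ} (𝔽 : FiniteField q) (n : ℕ) where
  open FiniteField 𝔽

  Vect : Set
  Vect = Vec F n

  zeroV : Vect
  zeroV = replicate n 0#

  _+V_ : Vect → Vect → Vect
  _+V_ = zipWith _+F_

  _·V_ : F → Vect → Vect
  a ·V v = map (a *F_) v

  lincomb : ∀ {d} → (Fin d → F) → (Fin d → Vect) → Vect
  lincomb {zero} c b = zeroV
  lincomb {suc d} c b = (c Fin.zero ·V b Fin.zero) +V lincomb (λ i → c (Fin.suc i)) (λ i → b (Fin.suc i))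

  record Subspace : Set₁ where
    field
      mem : Vect → Set
      mem-zero : mem zeroV
      mem-+ : ∀ u v → mem u → mem v → mem (u +V v)
      mem-· : ∀ a v → mem v → mem (a ·V v)
  open Subspace public

  HasDim : (Vect → Set) → ℕ → Set
  HasDim P d = Σ (Fin d → Vect) λ b →
      (∀ i → P (b i))
    × (∀ c → lincomb c b ≡ zeroV → ∀ i → c i ≡ 0#)
    × (∀ v → P v → ∃ λ c → v ≡ lincomb c b)

  _∩_ : Subspace → Subspace → Vect → Set
  (U ∩ W) v = mem U v × mem W v

  SameSubspace : Subspace → Subspace → Set
  SameSubspace U W = ∀ v → (mem U v → mem W v) × (mem W v → mem U v)

prodℕ : ℕ → (ℕ → ℕ) → ℕ
prodℕ zero f = 1
prodℕ (suc k) f = f k * prodℕ k f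

-- division, returning 0 when the divisor is 0 (never used in that case for q ≥ 2)
_div_ : ℕ → ℕ → ℕ
a div zero = 0
a div suc d = a / suc d

gauss : ℕ → ℕ → ℕ → ℕ
gauss q n k = prodℕ k (λ i → q ^ (n ∸ i) ∸ 1) div prodℕ k (λ i → q ^ (k ∸ i) ∸ 1)

-- Gaussian binomial with integer lower index s - i, which is 0 when s - i < 0
gaussSub : ℕ → ℕ → ℕ → ℕ → ℕ
gaussSub q N s i = if i ≤ᵇ s then gauss q N (s ∸ i) else 0

bound : ℕ → ℕ → ℕ → ℕ → ℕ
bound q N s zero = 0
bound q N s (suc r) = gaussSub q N s r + bound q N s r

maxF : ∀ {m} → (Fin m → ℕ) → ℕ
maxF {zero} f = 0
maxF {suc m} f = f Fin.zero ⊔ maxF (λ i → f (Fin.suc i))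

{-# OPTIONS --safe #-}
module Submission where

-- Dimensions are measured by counting: a subspace has dimension d iff it has q^d vectors. Write l for the
-- least element of L. If all members of the family contain a common subspace A of dimension l, pass to the
-- quotient by A and apply the Alon-Babai-Suzuki bound there. Otherwise some T of dimension at most k^2 (a
-- member, or the sum of two members meeting in dimension l and a third one not containing their
-- intersection) meets every member in dimension more than l. Hence every member contains one of the
-- at most [k^2, l+1] subspaces of T of dimension l+1; the members containing a given one of them have
-- pairwise intersections in L without l, so the bound for s - 1 in the quotient applies to them, and the
-- assumption on n absorbs the factor [k^2, l+1], because (q^j - 1) [N, j] = (q^N - 1) [N-1, j-1].

open import Defs
open import Data.Nat using (ℕ; suc; _+_; _*_; _∸_; _^_; _≤_; _<_)
open import Data.Integer using (+_) renaming (_+_ to _+ℤ_; _-_ to _-ℤ_; _<_ to _<ℤ_)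
open import Data.Fin using (Fin)
import Data.Fin as Fin
open import Data.Product using (∃; _×_)
open import Relation.Binary.PropositionalEquality using (_≡_; _≢_)
open import Relation.Nullary using (¬_)
open import Function.Definitions using (Injective)

open import Algebra.Bundles using (AbelianGroup; CommutativeRing)
import Algebra.Properties.Group as GroupProperties
import Algebra.Properties.Ring as RingProperties
import Algebra.Solver.CommutativeMonoid as MonoidSolver
import Data.Fin.Properties as Finₚ
open import Data.Fin using (inject≤; punchIn; combine; remQuot; splitAt; join)
open import Data.Integer using (ℤ; 0ℤ; 1ℤ) renaming (_*_ to _*ℤ_; -_ to negℤ)
import Data.Integer.Properties as ℤₚ
import Data.Integer.Tactic.RingSolver as ℤ-Solver
open import Data.Nat using (zero; s≤s; z≤n; _≤ᵇ_; >-nonZero)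
open import Data.Nat.DivMod using (m*n/n≡m)
open import Data.Nat.Induction using (<-wellFounded)
import Data.Nat.Properties as ℕₚ
import Data.Nat.Tactic.RingSolver as ℕ-Solver
open import Data.Product using (Σ; _,_; proj₁; proj₂)
open import Data.Sum using (_⊎_; inj₁; inj₂; [_,_]′)
import Data.Sum as Sum
import Data.Sum.Properties as Sumₚ
open import Data.Unit using (⊤; tt)
open import Data.Vec using (Vec; []; _∷_; map; zipWith; replicate; lookup; tabulate)
import Data.Vec.Properties as Vecₚ
open import Data.Vec.Functional using (insertAt)
open import Data.Vec.Functional.Properties using (insertAt-lookup; insertAt-punchIn)
open import Function.Bundles using (module Inverse)
open import Induction.WellFounded using (Acc; acc)
open import Relation.Binary.PropositionalEquality
open import Relation.Binary.PropositionalEquality.Algebra using (isMagma)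
open import Relation.Nullary using (Dec; yes; no; contradiction; ¬?)
import Relation.Nullary.Decidable as Decidable
open import Relation.Nullary.Decidable using (decidable-stable)
open import Relation.Unary using (Decidable)
open import Algebra.Properties.Semiring.Sum ℤₚ.+-*-semiring
  using (sum; sum-remove; ∑-distrib-+; *-distribˡ-sum; *-distribʳ-sum; sum-cong-≗; ∑-comm)

-- Sums and products of integers

-- The Alon-Babai-Suzuki bound comes from linear independence of integer-valued functions of a
-- subspace X of F^n. The number of vectors of U lying in X is a sum of indicators of v ∈ X, and
-- each such indicator has degree one, so a product of s factors |U ∩ X| - q^l lies in the span of
-- the functions x_A (1 if A lies in X, 0 otherwise) with dim A ≤ s. There are [n,0] + ... + [n,s]
-- of these; auxiliary functions, one for each subspace of dimension at most s - r, use up [n,0] +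
-- ... + [n,s-r], and the difference is the bound. Subspaces therefore have to be enumerated and
-- compared, which is why they are replaced by echelon codes. The constant k^2 is a convenient bound
-- for 3k - 2l, which bounds the dimension of the sum of three members. It is valid because l ≥ 1
-- there: for l = 0 the zero subspace is a common core. When r > s, the hypothesis on the k_i leaves
-- room for a member of dimension less than l; a family with such a member has no other one.

sum-zero : ∀ {n} {f : Fin n → ℤ} → (∀ i → f i ≡ 0ℤ) → sum f ≡ 0ℤ
sum-zero {zero}  f≡0 = refl
sum-zero {suc n} f≡0 = cong₂ _+ℤ_ (f≡0 Fin.zero) (sum-zero λ i → f≡0 (Fin.suc i))

sum-single : ∀ {n} (f : Fin n → ℤ) i → (∀ j → j ≢ i → f j ≡ 0ℤ) → sum f ≡ f i
sum-single {suc n} f i off = trans (sum-remove {i = i} f)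
  (trans (cong (f i +ℤ_) (sum-zero λ j → off _ (Finₚ.punchInᵢ≢i i j))) (ℤₚ.+-identityʳ (f i)))

product : ∀ {n} → (Fin n → ℤ) → ℤ
product {zero}  f = 1ℤ
product {suc n} f = f Fin.zero *ℤ product (λ i → f (Fin.suc i))

product-zero : ∀ {n} (f : Fin n → ℤ) i → f i ≡ 0ℤ → product f ≡ 0ℤ
product-zero f Fin.zero    eq = cong (_*ℤ product (λ i → f (Fin.suc i))) eq
product-zero f (Fin.suc i) eq = trans (cong (f Fin.zero *ℤ_) (product-zero (λ i → f (Fin.suc i)) i eq)) (ℤₚ.*-zeroʳ (f Fin.zero))

product-nonzero : ∀ {n} (f : Fin n → ℤ) → (∀ i → f i ≢ 0ℤ) → product f ≢ 0ℤ
product-nonzero {zero}  f f≢0 ()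
product-nonzero {suc n} f f≢0 eq = [ f≢0 Fin.zero , product-nonzero (λ i → f (Fin.suc i)) (λ i → f≢0 (Fin.suc i)) ]′
  (ℤₚ.i*j≡0⇒i≡0∨j≡0 (f Fin.zero) eq)

-- Linear dependence over the integers

-- Fraction-free elimination, so that no field of fractions is needed.
dependent : ∀ D (v : Fin (suc D) → Fin D → ℤ) →
  Σ (Fin (suc D) → ℤ) λ c → (∃ λ i → c i ≢ 0ℤ) × (∀ k → sum (λ i → c i *ℤ v i k) ≡ 0ℤ)
dependent zero v = (λ _ → 1ℤ) , (Fin.zero , λ ()) , λ ()
dependent (suc D) v with Finₚ.any? (λ i → ¬? (v i Fin.zero ℤₚ.≟ 0ℤ))
... | yes (p , a≢0) with dependent D (λ j k → v p Fin.zero *ℤ v (punchIn p j) (Fin.suc k)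
                                            -ℤ v (punchIn p j) Fin.zero *ℤ v p (Fin.suc k))
...   | c′ , (j , c′j≢0) , rel = c , (punchIn p j , cj≢0) , vanish
  where
    a : ℤ
    a = v p Fin.zero

    head : Fin (suc D) → ℤ
    head j = v (punchIn p j) Fin.zero

    -- The weight of the pivot `v p`: coordinate zero of the combination is b a plus the sum of a
    -- c′_j head_j, and this choice cancels it.
    b : ℤ
    b = negℤ (sum (λ j → c′ j *ℤ head j))

    c : Fin (suc (suc D)) → ℤ
    c = insertAt (λ j → a *ℤ c′ j) p b

    c-rest : ∀ j → c (punchIn p j) ≡ a *ℤ c′ j
    c-rest = insertAt-punchIn (λ j → a *ℤ c′ j) p b

    cj≢0 : c (punchIn p j) ≢ 0ℤ
    cj≢0 eq = [ a≢0 , c′j≢0 ]′ (ℤₚ.i*j≡0⇒i≡0∨j≡0 a (trans (sym (c-rest j)) eq))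

    split : ∀ k → sum (λ i → c i *ℤ v i k)
                ≡ b *ℤ v p k +ℤ sum (λ j → (a *ℤ c′ j) *ℤ v (punchIn p j) k)
    split k = trans (sum-remove {i = p} (λ i → c i *ℤ v i k))
      (cong₂ _+ℤ_ (cong (_*ℤ v p k) (insertAt-lookup (λ j → a *ℤ c′ j) p b))
                  (sum-cong-≗ (λ j → cong (_*ℤ v (punchIn p j) k) (c-rest j))))

    pull : ∀ x → b *ℤ x ≡ sum (λ j → (negℤ (c′ j *ℤ head j)) *ℤ x)
    pull x = trans (trans (assoc (sum (λ j → c′ j *ℤ head j)) x)
                          (*-distribʳ-sum (negℤ x) (λ j → c′ j *ℤ head j)))
                   (sum-cong-≗ (λ j → sym (assoc (c′ j *ℤ head j) x)))
      where
        assoc : ∀ s x → negℤ s *ℤ x ≡ s *ℤ negℤ x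
        assoc = ℤ-Solver.solve-∀

    vanish : ∀ k → sum (λ i → c i *ℤ v i k) ≡ 0ℤ
    vanish k = trans (split k)
      (trans (cong (_+ℤ sum (λ j → (a *ℤ c′ j) *ℤ v (punchIn p j) k)) (pull (v p k)))
      (trans (sym (∑-distrib-+ (λ j → (negℤ (c′ j *ℤ head j)) *ℤ v p k) (λ j → (a *ℤ c′ j) *ℤ v (punchIn p j) k)))
             (rest k)))
      where
        rest : ∀ k → sum (λ j → (negℤ (c′ j *ℤ head j)) *ℤ v p k +ℤ (a *ℤ c′ j) *ℤ v (punchIn p j) k) ≡ 0ℤ
        rest Fin.zero = sum-zero λ j → identity (c′ j) (head j) a
          where
            identity : ∀ x y z → negℤ (x *ℤ y) *ℤ z +ℤ (z *ℤ x) *ℤ y ≡ 0ℤ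
            identity = ℤ-Solver.solve-∀
        rest (Fin.suc k) = trans (sum-cong-≗ (λ j → identity (c′ j) (head j) (v p (Fin.suc k)) a (v (punchIn p j) (Fin.suc k)))) (rel k)
          where
            identity : ∀ x y w z u → negℤ (x *ℤ y) *ℤ w +ℤ (z *ℤ x) *ℤ u ≡ x *ℤ (z *ℤ u -ℤ y *ℤ w)
            identity = ℤ-Solver.solve-∀
-- All vectors vanish in coordinate zero, so the first one gets weight 0 and the others live in one
-- dimension less.
dependent (suc D) v | no zeros with dependent D (λ j k → v (Fin.suc j) (Fin.suc k))
... | c′ , (j , c′j≢0) , rel = c , (Fin.suc j , c′j≢0) , vanish
  where
    c : Fin (suc (suc D)) → ℤ
    c Fin.zero    = 0ℤ
    c (Fin.suc i) = c′ i

    vanish : ∀ k → sum (λ i → c i *ℤ v i k) ≡ 0ℤ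
    vanish Fin.zero = sum-zero λ i →
      trans (cong (c i *ℤ_) (decidable-stable (v i Fin.zero ℤₚ.≟ 0ℤ) λ ne → zeros (i , ne))) (ℤₚ.*-zeroʳ (c i))
    vanish (Fin.suc k) = trans (ℤₚ.+-identityˡ _) (rel k)

-- Ordered by rank, the matrix (h i (w j)) is triangular, so the functions h i are independent.
triangular-bound : ∀ {X : Set} {p D}
  (h : Fin p → X → ℤ) (w : Fin p → X) (rank : Fin p → ℕ)
  (basis : Fin D → X → ℤ) (coeff : Fin p → Fin D → ℤ)
  → (∀ i x → h i x ≡ sum (λ k → coeff i k *ℤ basis k x))
  → (∀ i → h i (w i) ≢ 0ℤ)
  → (∀ i j → i ≢ j → rank j ≤ rank i → h i (w j) ≡ 0ℤ)
  → p ≤ D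
triangular-bound {X} {p} {D} h w rank basis coeff expand diag lower with p ℕₚ.≤? D
... | yes p≤D = p≤D
... | no p≰D = contradiction (c≡0 i (<-wellFounded _)) ci≢0
  where
    ι : Fin (suc D) → Fin p
    ι k = inject≤ k (ℕₚ.≰⇒> p≰D)

    relation = dependent D (λ i → coeff (ι i))

    c : Fin (suc D) → ℤ
    c = proj₁ relation

    i : Fin (suc D)
    i = proj₁ (proj₁ (proj₂ relation))

    ci≢0 : c i ≢ 0ℤ
    ci≢0 = proj₂ (proj₁ (proj₂ relation))

    combination : ∀ x → sum (λ i → c i *ℤ h (ι i) x) ≡ 0ℤ
    combination x = begin
      sum (λ i → c i *ℤ h (ι i) x)
        ≡⟨ sum-cong-≗ (λ i → trans (cong (c i *ℤ_) (expand (ι i) x))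
                                   (*-distribˡ-sum (c i) (λ k → coeff (ι i) k *ℤ basis k x))) ⟩
      sum (λ i → sum (λ k → c i *ℤ (coeff (ι i) k *ℤ basis k x)))
        ≡⟨ ∑-comm (λ i k → c i *ℤ (coeff (ι i) k *ℤ basis k x)) ⟩
      sum (λ k → sum (λ i → c i *ℤ (coeff (ι i) k *ℤ basis k x)))
        ≡⟨ sum-zero (λ k → trans (sum-cong-≗ (λ i → sym (ℤₚ.*-assoc (c i) (coeff (ι i) k) (basis k x))))
              (trans (sym (*-distribʳ-sum (basis k x) (λ i → c i *ℤ coeff (ι i) k)))
                     (cong (_*ℤ basis k x) (proj₂ (proj₂ relation) k)))) ⟩
      0ℤ ∎
      where open ≡-Reasoning

    -- Evaluation of the relation at the point of `i` kills the other functions of at least the same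
    -- rank; those of smaller rank have coefficient zero by induction.
    c≡0 : ∀ i → Acc _<_ (rank (ι i)) → c i ≡ 0ℤ
    c≡0 i (acc below) = [ (λ eq → eq) , (λ eq → contradiction eq (diag (ι i))) ]′
      (ℤₚ.i*j≡0⇒i≡0∨j≡0 (c i) (begin
        c i *ℤ h (ι i) (w (ι i))
          ≡⟨ sym (ℤₚ.+-identityʳ _) ⟩
        c i *ℤ h (ι i) (w (ι i)) +ℤ 0ℤ
          ≡⟨ cong (c i *ℤ h (ι i) (w (ι i)) +ℤ_) (sym (sum-zero other)) ⟩
        c i *ℤ h (ι i) (w (ι i)) +ℤ sum (λ j → c (punchIn i j) *ℤ h (ι (punchIn i j)) (w (ι i)))
          ≡⟨ sym (sum-remove {i = i} (λ j → c j *ℤ h (ι j) (w (ι i)))) ⟩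
        sum (λ j → c j *ℤ h (ι j) (w (ι i)))
          ≡⟨ combination (w (ι i)) ⟩
        0ℤ ∎))
      where
        open ≡-Reasoning
        other : ∀ j → c (punchIn i j) *ℤ h (ι (punchIn i j)) (w (ι i)) ≡ 0ℤ
        other j with rank (ι i) ℕₚ.≤? rank (ι (punchIn i j))
        ... | yes r≤ = trans (cong (c (punchIn i j) *ℤ_)
                  (lower _ _ (λ eq → Finₚ.punchInᵢ≢i i j (Finₚ.inject≤-injective _ _ _ _ eq)) r≤)) (ℤₚ.*-zeroʳ (c (punchIn i j)))
        ... | no r≰ = cong (_*ℤ h (ι (punchIn i j)) (w (ι i))) (c≡0 (punchIn i j) (below (ℕₚ.≰⇒> r≰)))

-- Gaussian binomial coefficients

module GaussianBinomial where
  open import Data.Bool using (true; false; T)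
  open ℕₚ

  -- For d > n the truncated exponent n ∸ d is harmless, since its cofactor is then 0.
  #subspaces : ℕ → ℕ → ℕ → ℕ
  #subspaces q n       zero    = 1
  #subspaces q zero    (suc d) = 0
  #subspaces q (suc n) (suc d) = #subspaces q n (suc d) + q ^ (n ∸ d) * #subspaces q n d

  #subspaces-> : ∀ q {n d} → n < d → #subspaces q n d ≡ 0
  #subspaces-> q {zero}  {suc d} _         = refl
  #subspaces-> q {suc n} {suc d} (s≤s n<d)
    rewrite #subspaces-> q {n} {suc d} (m<n⇒m<1+n n<d) | #subspaces-> q {n} {d} n<d = *-zeroʳ (q ^ (n ∸ d))

  #subspaces-suc : ∀ q n d → #subspaces q n d ≤ #subspaces q (suc n) d
  #subspaces-suc q n zero    = ≤-refl
  #subspaces-suc q n (suc d) = m≤m+n _ _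

  #subspaces-mono : ∀ q {n n′} d → n ≤ n′ → #subspaces q n d ≤ #subspaces q n′ d
  #subspaces-mono q {n} d n≤n′ with m≤n⇒∃[o]m+o≡n n≤n′
  ... | o , refl = go o
    where
      go : ∀ o → #subspaces q n d ≤ #subspaces q (n + o) d
      go zero    rewrite +-identityʳ n = ≤-refl
      go (suc o) rewrite +-suc n o = ≤-trans (go o) (#subspaces-suc q (n + o) d)

  prodℕ-shift : ∀ k f → prodℕ (suc k) f ≡ f 0 * prodℕ k (λ i → f (suc i))
  prodℕ-shift zero    f = refl
  prodℕ-shift (suc k) f = trans (cong (f (suc k) *_) (prodℕ-shift k f))
    (swap (f (suc k)) (f 0) (prodℕ k (λ i → f (suc i))))
    where
      swap : ∀ x y z → x * (y * z) ≡ y * (x * z)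
      swap = ℕ-Solver.solve-∀

  -- The q-analogue of the falling factorial: `gauss q n k` is `falling q n k` divided by
  -- `falling q k k`.
  falling : ℕ → ℕ → ℕ → ℕ
  falling q n k = prodℕ k (λ i → q ^ (n ∸ i) ∸ 1)

  falling-suc : ∀ q n k → falling q (suc n) (suc k) ≡ (q ^ suc n ∸ 1) * falling q n k
  falling-suc q n k = prodℕ-shift k (λ i → q ^ (suc n ∸ i) ∸ 1)

  -- With `S` a partial sum of Gaussian binomials, the bound consists of the top `r` terms of
  -- `S (suc s)`. Once `r` exceeds `s`, `gaussSub` contributes 0 and the truncated index stays at 0.
  bound-telescope : ∀ {q} (S : ℕ → ℕ) n s r
    → (∀ j → S (suc j) ≡ gauss q n j + S j)
    → bound q n s r + S (suc s ∸ r) ≡ S (suc s)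
  bound-telescope S n s zero    S-suc = refl
  bound-telescope {q} S n s (suc r) S-suc with r ≤ᵇ s in eq
  ... | true  = trans (step (gauss q n (s ∸ r)) (bound q n s r) (S (s ∸ r)))
      (trans (cong (λ z → bound q n s r + z) (trans (sym (S-suc (s ∸ r))) (cong S (sym (+-∸-assoc 1 r≤s)))))
             (bound-telescope S n s r S-suc))
    where
      r≤s : r ≤ s
      r≤s = ≤ᵇ⇒≤ r s (subst T (sym eq) _)
      step : ∀ x y z → (x + y) + z ≡ y + (x + z)
      step = ℕ-Solver.solve-∀
  ... | false = trans (cong (λ z → bound q n s r + S z) (trans (m≤n⇒m∸n≡0 s≤r) (sym (m≤n⇒m∸n≡0 s<r))))
                      (bound-telescope S n s r S-suc)
    where
      s<r : s < r
      s<r = ≰⇒> λ r≤s → subst T eq (≤⇒≤ᵇ r≤s)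
      s≤r : s ≤ r
      s≤r = <⇒≤ s<r

  module _ {q : ℕ} (2≤q : 2 ≤ q) where

    q^>0 : ∀ k → 0 < q ^ k
    q^>0 k = m^n>0 q {{>-nonZero (≤-trans (s≤s z≤n) 2≤q)}} k

    q^∸1>0 : ∀ k → 0 < q ^ suc k ∸ 1
    q^∸1>0 k = m<n⇒0<n∸m (≤-trans 2≤q (≤-trans (≤-reflexive (sym (*-identityʳ q))) (*-monoʳ-≤ q (q^>0 k))))

    q^-cancel-≤ : ∀ {a b} → q ^ a ≤ q ^ b → a ≤ b
    q^-cancel-≤ le = ≮⇒≥ λ b<a → <⇒≱ (^-monoʳ-< q 2≤q b<a) le

    q^-injective : ∀ {a b} → q ^ a ≡ q ^ b → a ≡ b
    q^-injective eq = ≤-antisym (q^-cancel-≤ (≤-reflexive eq)) (q^-cancel-≤ (≤-reflexive (sym eq)))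

    falling-self>0 : ∀ k → 0 < falling q k k
    falling-self>0 zero    = s≤s z≤n
    falling-self>0 (suc k) rewrite falling-suc q k k = *-mono-< (q^∸1>0 k) (falling-self>0 k)

    -- Multiplied out, the Pascal-type recursion reduces to (Q - 1) + Q (q^(d+1) - 1) = q^(n+1) - 1
    -- with Q = q^(n-d); for d > n both sides are 0. This form avoids division until `gauss` is
    -- unfolded.
    #subspaces-falling : ∀ n d → #subspaces q n d * falling q d d ≡ falling q n d
    #subspaces-falling n       zero    = refl
    #subspaces-falling zero    (suc d) = sym (cong (λ z → (q ^ z ∸ 1) * falling q 0 d) (0∸n≡0 d))
    #subspaces-falling (suc n) (suc d) with d ≤? n
    ... | yes d≤n = begin
      (#subspaces q n (suc d) + Q * #subspaces q n d) * falling q (suc d) (suc d)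
        ≡⟨ *-distribʳ-+ (falling q (suc d) (suc d)) (#subspaces q n (suc d)) (Q * #subspaces q n d) ⟩
      #subspaces q n (suc d) * falling q (suc d) (suc d) + Q * #subspaces q n d * falling q (suc d) (suc d)
        ≡⟨ cong₂ _+_ (#subspaces-falling n (suc d)) (cong (Q * #subspaces q n d *_) (falling-suc q d d)) ⟩
      (Q ∸ 1) * falling q n d + Q * #subspaces q n d * ((q ^ suc d ∸ 1) * falling q d d)
        ≡⟨ cong (λ z → (Q ∸ 1) * falling q n d + z) (regroup Q (#subspaces q n d) (q ^ suc d ∸ 1) (falling q d d)) ⟩
      (Q ∸ 1) * falling q n d + (Q * (q ^ suc d ∸ 1)) * (#subspaces q n d * falling q d d)
        ≡⟨ cong (λ z → (Q ∸ 1) * falling q n d + (Q * (q ^ suc d ∸ 1)) * z) (#subspaces-falling n d) ⟩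
      (Q ∸ 1) * falling q n d + (Q * (q ^ suc d ∸ 1)) * falling q n d
        ≡⟨ sym (*-distribʳ-+ (falling q n d) (Q ∸ 1) (Q * (q ^ suc d ∸ 1))) ⟩
      ((Q ∸ 1) + Q * (q ^ suc d ∸ 1)) * falling q n d
        ≡⟨ cong (_* falling q n d) total ⟩
      (q ^ suc n ∸ 1) * falling q n d
        ≡⟨ sym (falling-suc q n d) ⟩
      falling q (suc n) (suc d) ∎
      where
        open ≡-Reasoning
        Q = q ^ (n ∸ d)
        regroup : ∀ x y z w → x * y * (z * w) ≡ (x * z) * (y * w)
        regroup = ℕ-Solver.solve-∀
        total : (Q ∸ 1) + Q * (q ^ suc d ∸ 1) ≡ q ^ suc n ∸ 1
        total = begin
          (Q ∸ 1) + Q * (q ^ suc d ∸ 1)          ≡⟨ cong (λ z → (Q ∸ 1) + z) (trans (*-distribˡ-∸ Q (q ^ suc d) 1) (cong (Q * q ^ suc d ∸_) (*-identityʳ Q))) ⟩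
          (Q ∸ 1) + (Q * q ^ suc d ∸ Q)          ≡⟨ +-comm (Q ∸ 1) _ ⟩
          (Q * q ^ suc d ∸ Q) + (Q ∸ 1)          ≡⟨ sym (+-∸-assoc _ (q^>0 (n ∸ d))) ⟩
          (Q * q ^ suc d ∸ Q) + Q ∸ 1            ≡⟨ cong (_∸ 1) (m∸n+n≡m (m≤m*n Q (q ^ suc d) {{>-nonZero (q^>0 (suc d))}})) ⟩
          Q * q ^ suc d ∸ 1                      ≡⟨ cong (_∸ 1) (sym (^-distribˡ-+-* q (n ∸ d) (suc d))) ⟩
          q ^ (n ∸ d + suc d) ∸ 1                ≡⟨ cong (λ z → q ^ z ∸ 1) (trans (+-suc (n ∸ d) d) (cong suc (m∸n+n≡m d≤n))) ⟩
          q ^ suc n ∸ 1 ∎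
    ... | no d≰n rewrite falling-suc q n d | #subspaces-> q {n} {suc d} (m<n⇒m<1+n (≰⇒> d≰n))
                       | sym (#subspaces-falling n d) | #subspaces-> q {n} {d} (≰⇒> d≰n)
                       | *-zeroʳ (q ^ (n ∸ d)) = sym (*-zeroʳ (q ^ suc n ∸ 1))

    gauss≡#subspaces : ∀ n d → gauss q n d ≡ #subspaces q n d
    gauss≡#subspaces n d = trans (cong (_div falling q d d) (sym (#subspaces-falling n d)))
                                 (div-cancel (#subspaces q n d) (falling q d d) (falling-self>0 d))
      where
        div-cancel : ∀ a b → 0 < b → (a * b) div b ≡ a
        div-cancel a (suc b) _ = m*n/n≡m a (suc b)

    -- The q-analogue of (n + 1) C(n, d) = (d + 1) C(n + 1, d + 1); times `falling q d d`, both
    -- sides are `falling q (suc n) (suc d)`.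
    #subspaces-absorb : ∀ n d → (q ^ suc n ∸ 1) * #subspaces q n d ≡ (q ^ suc d ∸ 1) * #subspaces q (suc n) (suc d)
    #subspaces-absorb n d = *-cancelʳ-≡ _ _ (falling q d d) {{>-nonZero (falling-self>0 d)}} (begin
      (q ^ suc n ∸ 1) * #subspaces q n d * falling q d d
        ≡⟨ trans (*-assoc (q ^ suc n ∸ 1) _ _) (cong ((q ^ suc n ∸ 1) *_) (#subspaces-falling n d)) ⟩
      (q ^ suc n ∸ 1) * falling q n d
        ≡⟨ sym (falling-suc q n d) ⟩
      falling q (suc n) (suc d)
        ≡⟨ sym (#subspaces-falling (suc n) (suc d)) ⟩
      #subspaces q (suc n) (suc d) * falling q (suc d) (suc d)
        ≡⟨ cong (#subspaces q (suc n) (suc d) *_) (falling-suc q d d) ⟩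
      #subspaces q (suc n) (suc d) * ((q ^ suc d ∸ 1) * falling q d d)
        ≡⟨ regroup (#subspaces q (suc n) (suc d)) (q ^ suc d ∸ 1) (falling q d d) ⟩
      (q ^ suc d ∸ 1) * #subspaces q (suc n) (suc d) * falling q d d ∎)
      where
        open ≡-Reasoning
        regroup : ∀ x y z → x * (y * z) ≡ y * x * z
        regroup = ℕ-Solver.solve-∀

    -- After multiplication by q^(j+1) - 1, which is at most q^(t+1) - 1, the hypothesis bounds the
    -- left side by (q^N - 1) [N-1, j], and `#subspaces-absorb` turns this into the right side. For
    -- N = 0 the hypothesis forces X = 0.
    #subspaces-multiply : ∀ X N t j → j ≤ t → (q ^ suc t ∸ 1) * X + 1 ≤ q ^ N
      → X * #subspaces q (N ∸ 1) j ≤ #subspaces q N (suc j)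
    #subspaces-multiply zero    N    t j j≤t h = z≤n
    #subspaces-multiply (suc X) zero t j j≤t h = contradiction h
      (<⇒≱ (≤-trans (s≤s (s≤s z≤n)) (+-monoˡ-≤ 1 (*-mono-≤ (q^∸1>0 t) (s≤s (z≤n {X}))))))
    #subspaces-multiply X@(suc _) (suc N) t j j≤t h = *-cancelˡ-≤ (q ^ suc j ∸ 1) {{>-nonZero (q^∸1>0 j)}} (begin
      (q ^ suc j ∸ 1) * (X * #subspaces q N j)
        ≤⟨ *-monoˡ-≤ _ (∸-monoˡ-≤ 1 (^-monoʳ-≤ q {{>-nonZero (≤-trans (s≤s z≤n) 2≤q)}} (s≤s j≤t))) ⟩
      (q ^ suc t ∸ 1) * (X * #subspaces q N j)
        ≡⟨ sym (*-assoc (q ^ suc t ∸ 1) X _) ⟩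
      (q ^ suc t ∸ 1) * X * #subspaces q N j
        ≤⟨ *-monoˡ-≤ _ (m+n≤o⇒m≤o∸n ((q ^ suc t ∸ 1) * X) h) ⟩
      (q ^ suc N ∸ 1) * #subspaces q N j
        ≡⟨ #subspaces-absorb N j ⟩
      (q ^ suc j ∸ 1) * #subspaces q (suc N) (suc j) ∎)
      where open ≤-Reasoning

    -- Term by term: [N-1, t-i] is matched with [N, t+1-i], so `r` is the same on both sides. For i
    -- > t the left term is 0, even where the right one is [N, 0].
    bound-multiply : ∀ X N t r → (q ^ suc t ∸ 1) * X + 1 ≤ q ^ N
      → X * bound q (N ∸ 1) t r ≤ bound q N (suc t) r
    bound-multiply X N t zero    h = ≤-reflexive (*-zeroʳ X)
    bound-multiply X N t (suc r) h = ≤-trans (≤-reflexive (*-distribˡ-+ X (gaussSub q (N ∸ 1) t r) _))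
                                             (+-mono-≤ (term r) (bound-multiply X N t r h))
      where
        positive : ∀ r → r ≤ t → X * gauss q (N ∸ 1) (t ∸ r) ≤ gauss q N (suc t ∸ r)
        positive r r≤t rewrite +-∸-assoc 1 r≤t | gauss≡#subspaces (N ∸ 1) (t ∸ r) | gauss≡#subspaces N (suc (t ∸ r)) =
          #subspaces-multiply X N t (t ∸ r) (m∸n≤m t r) h
        term : ∀ r → X * gaussSub q (N ∸ 1) t r ≤ gaussSub q N (suc t) r
        term r with r ≤ᵇ t in eq | r ≤ᵇ suc t in eq′
        ... | true  | true  = positive r (≤ᵇ⇒≤ r t (subst T (sym eq) _))
        ... | true  | false = contradiction (≤⇒≤ᵇ (m≤n⇒m≤1+n (≤ᵇ⇒≤ r t (subst T (sym eq) _)))) (subst (λ b → ¬ T b) (sym eq′) λ ())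
        ... | false | _     = ≤-trans (≤-reflexive (*-zeroʳ X)) z≤n

    -- With more than `s` terms the sum reaches down to [N, 0] = 1.
    bound>0 : ∀ N s r → s < r → 0 < bound q N s r
    bound>0 N s (suc r) (s≤s s≤r) with s ≟ r
    ... | yes refl = ≤-trans (s≤s z≤n) (≤-trans (≤-reflexive (sym last)) (m≤m+n _ _))
      where
        last : gaussSub q N s s ≡ 1
        last with s ≤ᵇ s in eq
        ... | true rewrite n∸n≡0 s = refl
        ... | false = contradiction (≤⇒≤ᵇ (≤-refl {s})) (subst (λ b → ¬ T b) (sym eq) λ ())
    ... | no s≢r = ≤-trans (bound>0 N s r (≤∧≢⇒< s≤r s≢r)) (m≤n+m _ _)

  #subspaces< : ℕ → ℕ → ℕ → ℕ
  #subspaces< q n zero    = 0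
  #subspaces< q n (suc k) = #subspaces q n k + #subspaces< q n k

open GaussianBinomial

-- Counting the elements of a predicate

-- Only elements are compared, never proofs of `P`, so `P` need not be proposition-valued; `mem` of
-- a `Subspace` is an arbitrary `Set`-valued predicate.
record Card {X : Set} (P : X → Set) (k : ℕ) : Set where
  field
    elem      : Fin k → X
    elem∈     : ∀ i → P (elem i)
    injective : ∀ i j → elem i ≡ elem j → i ≡ j
    index     : ∀ x → P x → Fin k
    elem-index : ∀ x (p : P x) → elem (index x p) ≡ x

open Card

card-≤ : ∀ {X Y : Set} {P : X → Set} {Q : Y → Set} {a b} → Card P a → Card Q b
  → (f : ∀ x → P x → Y) → (∀ x p → Q (f x p)) → (∀ x x′ p p′ → f x p ≡ f x′ p′ → x ≡ x′)
  → a ≤ b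
card-≤ A B f f∈ f-inj = Finₚ.injective⇒≤ {f = λ i → index B (g i) (f∈ _ _)} λ {i} {j} eq →
  injective A i j (f-inj _ _ _ _
    (trans (sym (elem-index B _ _)) (trans (cong (elem B) eq) (elem-index B _ _))))
  where
    g = λ i → f (elem A i) (elem∈ A i)

-- The map may use the proof of `P x`, so `y` has to be recoverable only once `x` and that proof are
-- fixed. In `dim-⊞` the proof carries a chosen decomposition of a vector.
card-×-≤ : ∀ {X Y Z W : Set} {P : X → Set} {Q : Y → Set} {R : Z → Set} {S : W → Set} {a b c d}
  → Card P a → Card Q b → Card R c → Card S d
  → (f : ∀ x → P x → ∀ y → Q y → Z × W) → (∀ x p y r → R (proj₁ (f x p y r)) × S (proj₂ (f x p y r)))
  → (∀ {x p y r x′ p′ y′ r′} → f x p y r ≡ f x′ p′ y′ r′ → x ≡ x′)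
  → (∀ {x p y r y′ r′} → f x p y r ≡ f x p y′ r′ → y ≡ y′)
  → a * b ≤ c * d
card-×-≤ {a = a} {b} {c} {d} A B C D f f∈ f-inj₁ f-inj₂ = Finₚ.injective⇒≤ {f = λ k → h (remQuot b k)} λ {k} {l} eq →
  trans (sym (Finₚ.combine-remQuot {a} b k)) (trans (cong (λ z → combine (proj₁ z) (proj₂ z)) (h-inj _ _ eq)) (Finₚ.combine-remQuot {a} b l))
  where
    g : Fin a × Fin b → _
    g (i , j) = f (elem A i) (elem∈ A i) (elem B j) (elem∈ B j)

    h : Fin a × Fin b → Fin (c * d)
    h z = combine (index C _ (proj₁ (f∈ _ _ _ _))) (index D _ (proj₂ (f∈ (elem A (proj₁ z)) (elem∈ A _) (elem B (proj₂ z)) (elem∈ B _))))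

    h⇒g : ∀ y z → h y ≡ h z → g y ≡ g z
    h⇒g y z eq with Finₚ.combine-injective {c} {d} _ _ _ _ eq
    ... | eq₁ , eq₂ = cong₂ _,_
      (trans (sym (elem-index C _ _)) (trans (cong (elem C) eq₁) (elem-index C _ _)))
      (trans (sym (elem-index D _ _)) (trans (cong (elem D) eq₂) (elem-index D _ _)))

    h-inj : ∀ y z → h y ≡ h z → y ≡ z
    h-inj (i , j) (i′ , j′) eq with injective A i i′ (f-inj₁ (h⇒g (i , j) (i′ , j′) eq))
    ... | refl = cong (i ,_) (injective B j j′ (f-inj₂ (h⇒g (i , j) (i , j′) eq)))

card-⊆ : ∀ {X : Set} {P Q : X → Set} {a b} → Card P a → Card Q b → (∀ x → P x → Q x) → a ≤ b
card-⊆ A B P⊆Q = card-≤ A B (λ x _ → x) P⊆Q (λ _ _ _ _ eq → eq)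

card-unique : ∀ {X : Set} {P Q : X → Set} {a b} → Card P a → Card Q b
  → (∀ x → P x → Q x) → (∀ x → Q x → P x) → a ≡ b
card-unique A B P⊆Q Q⊆P = ℕₚ.≤-antisym (card-⊆ A B P⊆Q) (card-⊆ B A Q⊆P)

card-resp : ∀ {X : Set} {P Q : X → Set} {a} → (∀ x → P x → Q x) → (∀ x → Q x → P x) → Card P a → Card Q a
card-resp P⊆Q Q⊆P A = record
  { elem = elem A ; elem∈ = λ i → P⊆Q _ (elem∈ A i) ; injective = injective A
  ; index = λ x q → index A x (Q⊆P x q) ; elem-index = λ x q → elem-index A x (Q⊆P x q) }

card-map : ∀ {X Y : Set} {P : X → Set} {Q : Y → Set} {a} (f : X → Y)
  → (∀ x → P x → Q (f x)) → (∀ x x′ → f x ≡ f x′ → x ≡ x′) → (∀ y → Q y → ∃ λ x → P x × f x ≡ y)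
  → Card P a → Card Q a
card-map f f∈ f-inj onto A = record
  { elem = λ i → f (elem A i) ; elem∈ = λ i → f∈ _ (elem∈ A i)
  ; injective = λ i j eq → injective A i j (f-inj _ _ eq)
  ; index = λ y s → index A _ (proj₁ (proj₂ (onto y s)))
  ; elem-index = λ y s → trans (cong f (elem-index A _ _)) (proj₂ (proj₂ (onto y s))) }

card-× : ∀ {X Y : Set} {P : X → Set} {Q : Y → Set} {a b} → Card P a → Card Q b
  → Card (λ (xy : X × Y) → P (proj₁ xy) × Q (proj₂ xy)) (a * b)
card-× {a = a} {b} A B = record
  { elem       = λ k → elem A (proj₁ (remQuot {a} b k)) , elem B (proj₂ (remQuot {a} b k))
  ; elem∈      = λ k → elem∈ A _ , elem∈ B _
  ; injective  = λ k l eq → trans (sym (Finₚ.combine-remQuot {a} b k))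
      (trans (cong₂ combine (injective A _ _ (cong proj₁ eq)) (injective B _ _ (cong proj₂ eq)))
             (Finₚ.combine-remQuot {a} b l))
  ; index      = λ { (x , y) (p , q) → combine (index A x p) (index B y q) }
  ; elem-index = λ { (x , y) (p , q) → cong₂ _,_
      (trans (cong (λ z → elem A (proj₁ z)) (Finₚ.remQuot-combine {a} (index A x p) (index B y q))) (elem-index A x p))
      (trans (cong (λ z → elem B (proj₂ z)) (Finₚ.remQuot-combine {a} (index A x p) (index B y q))) (elem-index B y q)) }
  }

-- Search through the enumeration. This makes membership in a subspace decidable when only a basis
-- is given.
card-dec : ∀ {X : Set} {P : X → Set} {k} → (∀ (x y : X) → Dec (x ≡ y)) → Card P k
  → (∀ {x y} → x ≡ y → P x → P y) → Decidable P
card-dec _≟_ A resp x = Decidable.map′ (λ (i , eq) → resp eq (elem∈ A i))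
  (λ p → index A x p , elem-index A x p) (Finₚ.any? λ i → elem A i ≟ x)

card-Fin : ∀ m → Card (λ (_ : Fin m) → ⊤) m
card-Fin m = record { elem = λ i → i ; elem∈ = λ _ → tt ; injective = λ _ _ eq → eq ; index = λ i _ → i ; elem-index = λ _ _ → refl }

any-member? : ∀ {X : Set} {k} {P : X → Set} → Card (λ (_ : X) → ⊤) k → Decidable P → Dec (∃ P)
any-member? {P = P} A P? = Decidable.map′ (λ (i , p) → _ , p)
  (λ (x , p) → index A x tt , subst P (sym (elem-index A x tt)) p) (Finₚ.any? λ i → P? (elem A i))

all-members? : ∀ {X : Set} {k} {P : X → Set} → Card (λ (_ : X) → ⊤) k → Decidable P → Dec (∀ x → P x)
all-members? {P = P} A P? = Decidable.map′ (λ p x → subst P (elem-index A x tt) (p _))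
  (λ p i → p _) (Finₚ.all? λ i → P? (elem A i))

-- An element of `Q` outside `P` would give `suc a` distinct elements of `Q`.
card-full : ∀ {X : Set} {P Q : X → Set} {a b} → Card P a → Card Q b → Decidable P
  → (∀ x → P x → Q x) → b ≤ a → ∀ x → Q x → P x
card-full {X} {P} {Q} {a} {b} A B P? P⊆Q b≤a y q with P? y
... | yes p = p
... | no ¬p = contradiction (ℕₚ.≤-trans (Finₚ.injective⇒≤ g-inj) b≤a) (ℕₚ.1+n≰n)
  where
    f : Fin (suc a) → X
    f Fin.zero    = y
    f (Fin.suc i) = elem A i

    f∈ : ∀ i → Q (f i)
    f∈ Fin.zero    = q
    f∈ (Fin.suc i) = P⊆Q _ (elem∈ A i)

    f-inj : ∀ i j → f i ≡ f j → i ≡ j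
    f-inj Fin.zero    Fin.zero    eq = refl
    f-inj Fin.zero    (Fin.suc j) eq = contradiction (subst P (sym eq) (elem∈ A j)) ¬p
    f-inj (Fin.suc i) Fin.zero    eq = contradiction (subst P eq (elem∈ A i)) ¬p
    f-inj (Fin.suc i) (Fin.suc j) eq = cong Fin.suc (injective A i j eq)

    g-inj : ∀ {i j} → index B (f i) (f∈ i) ≡ index B (f j) (f∈ j) → i ≡ j
    g-inj {i} {j} eq = f-inj i j (trans (sym (elem-index B _ (f∈ i))) (trans (cong (elem B) eq) (elem-index B _ (f∈ j))))

module _ {P : Set} where
  indicator : Dec P → ℕ
  indicator (yes _) = 1
  indicator (no _)  = 0

  indicator-yes : (P? : Dec P) → P → indicator P? ≡ 1
  indicator-yes (yes _) p = refl
  indicator-yes (no ¬p) p = contradiction p ¬p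

  indicator-no : (P? : Dec P) → ¬ P → indicator P? ≡ 0
  indicator-no (yes p) ¬p = contradiction p ¬p
  indicator-no (no _)  ¬p = refl

  card-indicator : (P? : Dec P) → Card (λ (_ : Fin 1) → P) (indicator P?)
  card-indicator (yes p) = record
    { elem = λ i → i ; elem∈ = λ _ → p ; injective = λ _ _ eq → eq
    ; index = λ i _ → i ; elem-index = λ _ _ → refl }
  card-indicator (no ¬p) = record
    { elem = λ () ; elem∈ = λ () ; injective = λ ()
    ; index = λ _ p → contradiction p ¬p ; elem-index = λ _ p → contradiction p ¬p }

count : ∀ {n} {P : Fin n → Set} → Decidable P → ℕ
count {zero}  P? = 0
count {suc n} P? = indicator (P? Fin.zero) + count (λ i → P? (Fin.suc i))

card-⊎ : ∀ {X Y : Set} {P : X → Set} {Q : Y → Set} {a b} → Card P a → Card Q b → Card {X ⊎ Y} [ P , Q ]′ (a + b)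
card-⊎ {X} {Y} {P} {Q} {a} {b} A B = record
  { elem       = λ k → el (splitAt a k)
  ; elem∈      = λ k → el∈ (splitAt a k)
  ; injective  = λ k l eq → trans (sym (Finₚ.join-splitAt a b k))
      (trans (cong (join a b) (el-inj (splitAt a k) (splitAt a l) eq)) (Finₚ.join-splitAt a b l))
  ; index      = λ z p → join a b (ix z p)
  ; elem-index = λ z p → trans (cong el (Finₚ.splitAt-join a b (ix z p))) (el-ix z p)
  }
  where
    el : Fin a ⊎ Fin b → X ⊎ Y
    el = Sum.map (elem A) (elem B)

    el∈ : ∀ s → [ P , Q ]′ (el s)
    el∈ (inj₁ i) = elem∈ A i
    el∈ (inj₂ i) = elem∈ B i

    el-inj : ∀ s t → el s ≡ el t → s ≡ t
    el-inj (inj₁ i) (inj₁ j) eq = cong inj₁ (injective A i j (Sumₚ.inj₁-injective eq))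
    el-inj (inj₂ i) (inj₂ j) eq = cong inj₂ (injective B i j (Sumₚ.inj₂-injective eq))

    ix : ∀ z → [ P , Q ]′ z → Fin a ⊎ Fin b
    ix (inj₁ x) p = inj₁ (index A x p)
    ix (inj₂ y) p = inj₂ (index B y p)

    el-ix : ∀ z p → el (ix z p) ≡ z
    el-ix (inj₁ x) p = cong inj₁ (elem-index A x p)
    el-ix (inj₂ y) p = cong inj₂ (elem-index B y p)

card-count : ∀ {n} {P : Fin n → Set} (P? : Decidable P) → Card P (count P?)
card-count {zero}  P? = record { elem = λ () ; elem∈ = λ () ; injective = λ () ; index = λ () ; elem-index = λ () }
card-count {suc n} {P} P? = card-map join₁ join₁∈ join₁-inj join₁-onto
  (card-⊎ (card-indicator (P? Fin.zero)) (card-count (λ i → P? (Fin.suc i))))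
  where
    join₁ : Fin 1 ⊎ Fin n → Fin (suc n)
    join₁ = join 1 n

    join₁∈ : ∀ z → [ (λ _ → P Fin.zero) , (λ i → P (Fin.suc i)) ]′ z → P (join₁ z)
    join₁∈ (inj₁ Fin.zero) p = p
    join₁∈ (inj₂ i)        p = p

    join₁-inj : ∀ z z′ → join₁ z ≡ join₁ z′ → z ≡ z′
    join₁-inj z z′ eq = trans (sym (Finₚ.splitAt-join 1 n z)) (trans (cong (splitAt 1) eq) (Finₚ.splitAt-join 1 n z′))

    join₁-onto : ∀ i → P i → ∃ λ z → [ (λ _ → P Fin.zero) , (λ i → P (Fin.suc i)) ]′ z × join₁ z ≡ i
    join₁-onto Fin.zero    p = inj₁ Fin.zero , p , refl
    join₁-onto (Fin.suc i) p = inj₂ i , p , refl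

card-restrict : ∀ {X : Set} {P Q : X → Set} {a b} (A : Card P a)
  → Card (λ i → Q (elem A i)) b → (∀ {x y} → x ≡ y → Q x → Q y) → Card (λ x → P x × Q x) b
card-restrict A B resp = record
  { elem = λ k → elem A (elem B k)
  ; elem∈ = λ k → elem∈ A _ , elem∈ B k
  ; injective = λ k l eq → injective B k l (injective A _ _ eq)
  ; index = λ x (p , r) → index B (index A x p) (resp (sym (elem-index A x p)) r)
  ; elem-index = λ x (p , r) → trans (cong (elem A) (elem-index B _ _)) (elem-index A x p)
  }

-- Each `j` is encoded injectively by its value and its position within the fibre.
fiber-bound : ∀ {m c} (b : ℕ) (f : Fin m → Fin c)
  → (∀ i {k} → Card (λ j → f j ≡ i) k → k ≤ b) → m ≤ c * b
fiber-bound {m} {c} b f small = Finₚ.injective⇒≤ {f = λ j → combine (f j) (position j)} λ {j} {k} eq →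
    same j k (Finₚ.combine-injective (f j) _ (f k) _ eq)
  where
    fiber : ∀ i → Card (λ j → f j ≡ i) (count (λ j → f j Finₚ.≟ i))
    fiber i = card-count (λ j → f j Finₚ.≟ i)

    -- The fibre is a separate argument, so that the positions of `j` and `k` become comparable once
    -- `f j ≡ f k` is known.
    place : ∀ i j → f j ≡ i → Fin b
    place i j p = inject≤ (index (fiber i) j p) (small i (fiber i))

    position : Fin m → Fin b
    position j = place (f j) j refl

    place-inj : ∀ i j k (p : f j ≡ i) (r : f k ≡ i) → place i j p ≡ place i k r → j ≡ k
    place-inj i j k p r eq = trans (sym (elem-index (fiber i) j p))
      (trans (cong (elem (fiber i)) (Finₚ.inject≤-injective _ _ _ _ eq)) (elem-index (fiber i) k r))

    place-eq : ∀ i k (r : f k ≡ i) → place i k r ≡ position k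
    place-eq i k refl = refl

    same : ∀ j k → f j ≡ f k × position j ≡ position k → j ≡ k
    same j k (fj≡fk , eq) = place-inj (f j) j k refl (sym fj≡fk) (trans eq (sym (place-eq (f j) k (sym fj≡fk))))

-- Subspaces of F^n

module SubspaceFamilies {q : ℕ} (𝔽 : FiniteField q) where
  open FiniteField 𝔽

  F-ring : CommutativeRing _ _
  F-ring = record { isCommutativeRing = isCommutativeRing }

  private module R = CommutativeRing F-ring
  private module RP = RingProperties R.ring

  label-injective : ∀ {x y} → Inverse.to card x ≡ Inverse.to card y → x ≡ y
  label-injective {x} {y} eq = trans (sym (Inverse.strictlyInverseʳ card x))
    (trans (cong (Inverse.from card) eq) (Inverse.strictlyInverseʳ card y))

  _≟F_ : (x y : F) → Dec (x ≡ y)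
  x ≟F y = Decidable.map′ label-injective (cong (Inverse.to card)) (Inverse.to card x Finₚ.≟ Inverse.to card y)

  2≤q : 2 ≤ q
  2≤q = Finₚ.injective⇒≤ {f = f} (λ {i} {j} → f-inj i j)
    where
      f : Fin 2 → Fin q
      f Fin.zero    = Inverse.to card 0#
      f (Fin.suc _) = Inverse.to card 1#

      f-inj : ∀ i j → f i ≡ f j → i ≡ j
      f-inj Fin.zero Fin.zero eq = refl
      f-inj Fin.zero (Fin.suc Fin.zero) eq = contradiction (label-injective eq) 0≢1
      f-inj (Fin.suc Fin.zero) Fin.zero eq = contradiction (sym (label-injective eq)) 0≢1
      f-inj (Fin.suc Fin.zero) (Fin.suc Fin.zero) eq = refl

  -- The vector space structure of F^n

  infixl 6 _⊕_
  infixr 7 _⊙_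
  infix 8 ⊝_

  𝟘 : ∀ {n} → Vec F n
  𝟘 = replicate _ 0#

  _⊕_ : ∀ {n} → Vec F n → Vec F n → Vec F n
  _⊕_ = zipWith _+F_

  _⊙_ : ∀ {n} → F → Vec F n → Vec F n
  a ⊙ v = map (a *F_) v

  -- As a scalar multiple, the negative lies in every subspace by closure under scaling.
  ⊝_ : ∀ {n} → Vec F n → Vec F n
  ⊝ v = (-F 1#) ⊙ v

  _≟V_ : ∀ {n} (u v : Vec F n) → Dec (u ≡ v)
  _≟V_ = Vecₚ.≡-dec _≟F_

  ⊙-distribˡ : ∀ {n} a (u v : Vec F n) → a ⊙ (u ⊕ v) ≡ a ⊙ u ⊕ a ⊙ v
  ⊙-distribˡ a []       []       = refl
  ⊙-distribˡ a (x ∷ u) (y ∷ v) = cong₂ _∷_ (R.distribˡ a x y) (⊙-distribˡ a u v)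

  ⊙-distribʳ : ∀ {n} a b (u : Vec F n) → (a +F b) ⊙ u ≡ a ⊙ u ⊕ b ⊙ u
  ⊙-distribʳ a b []      = refl
  ⊙-distribʳ a b (x ∷ u) = cong₂ _∷_ (R.distribʳ x a b) (⊙-distribʳ a b u)

  ⊙-assoc : ∀ {n} a b (u : Vec F n) → (a *F b) ⊙ u ≡ a ⊙ (b ⊙ u)
  ⊙-assoc a b []      = refl
  ⊙-assoc a b (x ∷ u) = cong₂ _∷_ (R.*-assoc a b x) (⊙-assoc a b u)

  ⊙-identity : ∀ {n} (u : Vec F n) → 1# ⊙ u ≡ u
  ⊙-identity []      = refl
  ⊙-identity (x ∷ u) = cong₂ _∷_ (R.*-identityˡ x) (⊙-identity u)

  ⊙-zeroˡ : ∀ {n} (u : Vec F n) → 0# ⊙ u ≡ 𝟘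
  ⊙-zeroˡ []      = refl
  ⊙-zeroˡ (x ∷ u) = cong₂ _∷_ (R.zeroˡ x) (⊙-zeroˡ u)

  ⊙-zeroʳ : ∀ {n} a → a ⊙ 𝟘 {n} ≡ 𝟘
  ⊙-zeroʳ {zero}  a = refl
  ⊙-zeroʳ {suc n} a = cong₂ _∷_ (R.zeroʳ a) (⊙-zeroʳ a)

  ⊕-identityˡ : ∀ {n} (u : Vec F n) → 𝟘 ⊕ u ≡ u
  ⊕-identityˡ = Vecₚ.zipWith-identityˡ R.+-identityˡ

  ⊕-identityʳ : ∀ {n} (u : Vec F n) → u ⊕ 𝟘 ≡ u
  ⊕-identityʳ = Vecₚ.zipWith-identityʳ R.+-identityʳ

  ⊕-inverseʳ : ∀ {n} (u : Vec F n) → u ⊕ ⊝ u ≡ 𝟘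
  ⊕-inverseʳ u = trans (cong (_⊕ ⊝ u) (sym (⊙-identity u)))
    (trans (sym (⊙-distribʳ 1# (-F 1#) u)) (trans (cong (_⊙ u) (R.-‿inverseʳ 1#)) (⊙-zeroˡ u)))

  ⊕-group : ℕ → AbelianGroup _ _
  ⊕-group n = record
    { Carrier = Vec F n ; _≈_ = _≡_ ; _∙_ = _⊕_ ; ε = 𝟘 ; _⁻¹ = ⊝_
    ; isAbelianGroup = record
      { isGroup = record
        { isMonoid = record
          { isSemigroup = record
            { isMagma = isMagma _⊕_
            ; assoc = Vecₚ.zipWith-assoc R.+-assoc }
          ; identity = ⊕-identityˡ , ⊕-identityʳ }
        ; inverse = (λ u → trans (Vecₚ.zipWith-comm R.+-comm (⊝ u) u) (⊕-inverseʳ u)) , ⊕-inverseʳ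
        ; ⁻¹-cong = cong ⊝_ }
      ; comm = Vecₚ.zipWith-comm R.+-comm }
    }

  module _ {n : ℕ} where
    open AbelianGroup (⊕-group n) public
      using () renaming (assoc to ⊕-assoc; comm to ⊕-comm; inverseˡ to ⊕-inverseˡ; commutativeMonoid to ⊕-commutativeMonoid)
    open GroupProperties (AbelianGroup.group (⊕-group n)) public
      using () renaming (∙-cancelʳ to ⊕-cancelʳ; x∙y⁻¹≈ε⇒x≈y to ⊕⊝≡𝟘⇒≡)

  ⊕-interchange : ∀ {n} (a b c d : Vec F n) → (a ⊕ b) ⊕ (c ⊕ d) ≡ (a ⊕ c) ⊕ (b ⊕ d)
  ⊕-interchange {n} a b c d = solve 4 (λ a b c d → (a ⊹ b) ⊹ (c ⊹ d) ⊜ (a ⊹ c) ⊹ (b ⊹ d)) refl a b c d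
    where open MonoidSolver (⊕-commutativeMonoid {n}) renaming (_⊕_ to _⊹_)

  ⊕-⊝-cancel : ∀ {n} (u v : Vec F n) → (u ⊕ ⊝ v) ⊕ v ≡ u
  ⊕-⊝-cancel u v = trans (⊕-assoc u (⊝ v) v) (trans (cong (u ⊕_) (⊕-inverseˡ v)) (⊕-identityʳ u))

  ⊝-⊕-cancel : ∀ {n} (u v : Vec F n) → (u ⊕ v) ⊕ ⊝ v ≡ u
  ⊝-⊕-cancel u v = trans (⊕-assoc u v (⊝ v)) (trans (cong (u ⊕_) (⊕-inverseʳ v)) (⊕-identityʳ u))

  neg-⊙ : ∀ {n} a (u : Vec F n) → (-F a) ⊙ u ≡ ⊝ (a ⊙ u)
  neg-⊙ a u = trans (cong (_⊙ u) (sym (RP.-1*x≈-x a))) (⊙-assoc (-F 1#) a u)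

  ⊙-⊝ : ∀ {n} a (u : Vec F n) → a ⊙ ⊝ u ≡ ⊝ (a ⊙ u)
  ⊙-⊝ a u = trans (sym (⊙-assoc a (-F 1#) u)) (trans (cong (_⊙ u) (R.*-comm a (-F 1#))) (⊙-assoc (-F 1#) a u))

  scalars : Card (λ (_ : F) → ⊤) q
  scalars = record
    { elem = Inverse.from card ; elem∈ = λ _ → tt
    ; injective = λ i j eq → trans (sym (Inverse.strictlyInverseˡ card i)) (trans (cong (Inverse.to card) eq) (Inverse.strictlyInverseˡ card j))
    ; index = λ x _ → Inverse.to card x ; elem-index = λ x _ → Inverse.strictlyInverseʳ card x }

  vectors : ∀ n → Card (λ (_ : Vec F n) → ⊤) (q ^ n)
  vectors zero = record { elem = λ _ → [] ; elem∈ = λ _ → tt ; injective = λ { Fin.zero Fin.zero _ → refl }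
    ; index = λ _ _ → Fin.zero ; elem-index = λ { [] _ → refl } }
  vectors (suc n) = card-map (λ (x , v) → x ∷ v) (λ _ _ → tt)
    (λ { (x , v) (y , w) eq → cong₂ _,_ (Vecₚ.∷-injectiveˡ eq) (Vecₚ.∷-injectiveʳ eq) })
    (λ { (x ∷ v) _ → (x , v) , (tt , tt) , refl })
    (card-× scalars (vectors n))

  -- Decidable subspaces and their echelon codes

  record DecSubspace (n : ℕ) : Set₁ where
    field
      _∋_ : Vec F n → Set
      _∋?_ : Decidable _∋_
      ∋-𝟘 : _∋_ 𝟘
      ∋-⊕ : ∀ {u v} → _∋_ u → _∋_ v → _∋_ (u ⊕ v)
      ∋-⊙ : ∀ a {v} → _∋_ v → _∋_ (a ⊙ v)

    ∋-⊝ : ∀ {v} → _∋_ v → _∋_ (⊝ v)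
    ∋-⊝ = ∋-⊙ (-F 1#)

  open DecSubspace

  -- Echelon forms: `new U w` is spanned by {0} × U and the vector (1 , - section U w),
  -- so a d-dimensional subspace has exactly one code.
  data Sub : ℕ → ℕ → Set
  codim : ∀ {n d} → Sub n d → ℕ

  data Sub where
    nil : Sub 0 0
    ext : ∀ {n d} → Sub n d → Sub (suc n) d
    new : ∀ {n d} (U : Sub n d) → Vec F (codim U) → Sub (suc n) (suc d)

  codim nil       = 0
  codim (ext U)   = suc (codim U)
  codim (new U w) = codim U

  codim+dim : ∀ {n d} (U : Sub n d) → codim U + d ≡ n
  codim+dim nil               = refl
  codim+dim (ext U)           = cong suc (codim+dim U)
  codim+dim (new {d = d} U w) = trans (ℕₚ.+-suc (codim U) d) (cong suc (codim+dim U))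

  dim≤ : ∀ {n d} → Sub n d → d ≤ n
  dim≤ {n} {d} U = subst (d ≤_) (codim+dim U) (ℕₚ.m≤n+m d (codim U))

  codim≡ : ∀ {n d} (U : Sub n d) → codim U ≡ n ∸ d
  codim≡ {n} {d} U = trans (sym (ℕₚ.m+n∸n≡m (codim U) d)) (cong (_∸ d) (codim+dim U))

  -- The linear map onto F^codim whose kernel is the subspace. Modulo `new U w`, the vector (1 , 0)
  -- equals (0 , section U w), hence the summand `x ⊙ w`.
  quotient : ∀ {n d} (U : Sub n d) → Vec F n → Vec F (codim U)
  quotient nil       []      = []
  quotient (ext U)   (x ∷ v) = x ∷ quotient U v
  quotient (new U w) (x ∷ v) = quotient U v ⊕ x ⊙ w

  -- A right inverse of `quotient U`: the representative of a coset whose pivot coordinates, those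
  -- added by `new`, are 0.
  section : ∀ {n d} (U : Sub n d) → Vec F (codim U) → Vec F n
  section nil       []      = []
  section (ext U)   (x ∷ w) = x ∷ section U w
  section (new U _) w       = 0# ∷ section U w

  -- An isomorphism of F^d onto the subspace, with the pivot coordinates as parameters.
  embed : ∀ {n d} → Sub n d → Vec F d → Vec F n
  embed nil       []      = []
  embed (ext U)   v       = 0# ∷ embed U v
  embed (new U w) (x ∷ v) = x ∷ embed U v ⊕ ⊝ (x ⊙ section U w)

  quotient-⊕ : ∀ {n d} (U : Sub n d) u v → quotient U (u ⊕ v) ≡ quotient U u ⊕ quotient U v
  quotient-⊕ nil       []      []      = refl
  quotient-⊕ (ext U)   (x ∷ u) (y ∷ v) = cong (x +F y ∷_) (quotient-⊕ U u v)
  quotient-⊕ (new U w) (x ∷ u) (y ∷ v) = trans (cong₂ _⊕_ (quotient-⊕ U u v) (⊙-distribʳ x y w))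
    (⊕-interchange (quotient U u) (quotient U v) (x ⊙ w) (y ⊙ w))

  quotient-⊙ : ∀ {n d} (U : Sub n d) a v → quotient U (a ⊙ v) ≡ a ⊙ quotient U v
  quotient-⊙ nil       a []      = refl
  quotient-⊙ (ext U)   a (x ∷ v) = cong (a *F x ∷_) (quotient-⊙ U a v)
  quotient-⊙ (new U w) a (x ∷ v) = trans (cong₂ _⊕_ (quotient-⊙ U a v) (⊙-assoc a x w))
    (sym (⊙-distribˡ a (quotient U v) (x ⊙ w)))

  quotient-𝟘 : ∀ {n d} (U : Sub n d) → quotient U 𝟘 ≡ 𝟘
  quotient-𝟘 U = trans (cong (quotient U) (sym (⊙-zeroˡ 𝟘))) (trans (quotient-⊙ U 0# 𝟘) (⊙-zeroˡ _))

  section-⊕ : ∀ {n d} (U : Sub n d) u v → section U (u ⊕ v) ≡ section U u ⊕ section U v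
  section-⊕ nil       []      []      = refl
  section-⊕ (ext U)   (x ∷ u) (y ∷ v) = cong (x +F y ∷_) (section-⊕ U u v)
  section-⊕ (new U _) u       v       = cong₂ _∷_ (sym (R.+-identityˡ 0#)) (section-⊕ U u v)

  section-⊙ : ∀ {n d} (U : Sub n d) a v → section U (a ⊙ v) ≡ a ⊙ section U v
  section-⊙ nil       a []      = refl
  section-⊙ (ext U)   a (x ∷ v) = cong (a *F x ∷_) (section-⊙ U a v)
  section-⊙ (new U _) a v       = cong₂ _∷_ (sym (R.zeroʳ a)) (section-⊙ U a v)

  section-𝟘 : ∀ {n d} (U : Sub n d) → section U 𝟘 ≡ 𝟘
  section-𝟘 U = trans (cong (section U) (sym (⊙-zeroˡ 𝟘))) (trans (section-⊙ U 0# 𝟘) (⊙-zeroˡ _))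

  quotient-section : ∀ {n d} (U : Sub n d) w → quotient U (section U w) ≡ w
  quotient-section nil       []      = refl
  quotient-section (ext U)   (x ∷ w) = cong (x ∷_) (quotient-section U w)
  quotient-section (new U w) w′      = trans (cong₂ _⊕_ (quotient-section U w′) (⊙-zeroˡ w)) (⊕-identityʳ w′)

  embed-⊕ : ∀ {n d} (U : Sub n d) u v → embed U (u ⊕ v) ≡ embed U u ⊕ embed U v
  embed-⊕ nil       []      []      = refl
  embed-⊕ (ext U)   u       v       = cong₂ _∷_ (sym (R.+-identityˡ 0#)) (embed-⊕ U u v)
  embed-⊕ (new U w) (x ∷ u) (y ∷ v) = cong (x +F y ∷_)
    (trans (cong₂ _⊕_ (embed-⊕ U u v) (trans (cong ⊝_ (⊙-distribʳ x y _)) (⊙-distribˡ (-F 1#) _ _)))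
           (⊕-interchange (embed U u) (embed U v) _ _))

  embed-⊙ : ∀ {n d} (U : Sub n d) a v → embed U (a ⊙ v) ≡ a ⊙ embed U v
  embed-⊙ nil       a []      = refl
  embed-⊙ (ext U)   a v       = cong₂ _∷_ (sym (R.zeroʳ a)) (embed-⊙ U a v)
  embed-⊙ (new U w) a (x ∷ v) = cong (a *F x ∷_)
    (trans (cong₂ _⊕_ (embed-⊙ U a v) (trans (cong ⊝_ (⊙-assoc a x _)) (sym (⊙-⊝ a _))))
           (sym (⊙-distribˡ a (embed U v) _)))

  embed-𝟘 : ∀ {n d} (U : Sub n d) → embed U 𝟘 ≡ 𝟘
  embed-𝟘 U = trans (cong (embed U) (sym (⊙-zeroˡ 𝟘))) (trans (embed-⊙ U 0# 𝟘) (⊙-zeroˡ _))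

  quotient-embed : ∀ {n d} (U : Sub n d) v → quotient U (embed U v) ≡ 𝟘
  quotient-embed nil       []      = refl
  quotient-embed (ext U)   v       = cong (0# ∷_) (quotient-embed U v)
  quotient-embed (new U w) (x ∷ v) = begin
    quotient U (embed U v ⊕ ⊝ (x ⊙ section U w)) ⊕ x ⊙ w
      ≡⟨ cong (_⊕ x ⊙ w) (trans (quotient-⊕ U _ _) (cong₂ _⊕_ (quotient-embed U v)
           (trans (quotient-⊙ U (-F 1#) _) (cong ⊝_ (trans (quotient-⊙ U x _) (cong (x ⊙_) (quotient-section U w))))))) ⟩
    (𝟘 ⊕ ⊝ (x ⊙ w)) ⊕ x ⊙ w ≡⟨ ⊕-⊝-cancel 𝟘 (x ⊙ w) ⟩
    𝟘 ∎
    where open ≡-Reasoning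

  embed-injective : ∀ {n d} (U : Sub n d) u v → embed U u ≡ embed U v → u ≡ v
  embed-injective nil       []      []      eq = refl
  embed-injective (ext U)   u       v       eq = embed-injective U u v (Vecₚ.∷-injectiveʳ eq)
  embed-injective (new U w) (x ∷ u) (y ∷ v) eq with Vecₚ.∷-injectiveˡ eq
  ... | refl = cong (x ∷_) (embed-injective U u v (⊕-cancelʳ (⊝ (x ⊙ section U w)) _ _ (Vecₚ.∷-injectiveʳ eq)))

  embed-onto : ∀ {n d} (U : Sub n d) v → quotient U v ≡ 𝟘 → ∃ λ u → embed U u ≡ v
  embed-onto nil       []      _  = [] , refl
  embed-onto (ext U)   (x ∷ v) eq with embed-onto U v (Vecₚ.∷-injectiveʳ eq)
  ... | u , refl = u , cong (_∷ embed U u) (sym (Vecₚ.∷-injectiveˡ eq))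
  embed-onto (new U w) (x ∷ v) eq with embed-onto U (v ⊕ x ⊙ section U w)
        (trans (quotient-⊕ U _ _) (trans (cong (quotient U v ⊕_) (trans (quotient-⊙ U x _) (cong (x ⊙_) (quotient-section U w)))) eq))
  ... | u , eq′ = x ∷ u , cong (x ∷_) (trans (cong (_⊕ ⊝ (x ⊙ section U w)) eq′) (⊝-⊕-cancel v _))

  ⟦_⟧ : ∀ {n d} → Sub n d → DecSubspace n
  ⟦ U ⟧ = record
    { _∋_  = λ v → quotient U v ≡ 𝟘
    ; _∋?_ = λ v → quotient U v ≟V 𝟘
    ; ∋-𝟘  = quotient-𝟘 U
    ; ∋-⊕  = λ p r → trans (quotient-⊕ U _ _) (trans (cong₂ _⊕_ p r) (⊕-identityˡ 𝟘))
    ; ∋-⊙  = λ a p → trans (quotient-⊙ U a _) (trans (cong (a ⊙_) p) (⊙-zeroʳ a))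
    }

  card-⟦⟧ : ∀ {n d} (U : Sub n d) → Card (⟦ U ⟧ ∋_) (q ^ d)
  card-⟦⟧ {d = d} U = card-map (embed U) (λ v _ → quotient-embed U v) (embed-injective U)
    (λ v p → proj₁ (embed-onto U v p) , tt , proj₂ (embed-onto U v p)) (vectors d)

  infix 4 _⊑_
  _⊑_ : ∀ {n} → DecSubspace n → DecSubspace n → Set
  P ⊑ Q = ∀ v → P ∋ v → Q ∋ v

  _⊑?_ : ∀ {n} (P Q : DecSubspace n) → Dec (P ⊑ Q)
  P ⊑? Q = all-members? (vectors _) λ v → (P ∋? v) Decidable.→-dec (Q ∋? v)

  -- Subspaces as plain data: by `code-unique`, propositional equality of codes is equality of
  -- subspaces, and codes can be enumerated.
  Code : ℕ → Set
  Code n = ∃ λ d → Sub n d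

  dimension : ∀ {n} → Code n → ℕ
  dimension = proj₁

  ⟪_⟫ : ∀ {n} → Code n → DecSubspace n
  ⟪ _ , U ⟫ = ⟦ U ⟧

  slice : ∀ {n} → DecSubspace (suc n) → DecSubspace n
  slice P = record
    { _∋_ = λ v → P ∋ (0# ∷ v) ; _∋?_ = λ v → P ∋? (0# ∷ v) ; ∋-𝟘 = ∋-𝟘 P
    ; ∋-⊕ = λ p r → subst (P ∋_) (cong (_∷ _) (R.+-identityˡ 0#)) (∋-⊕ P p r)
    ; ∋-⊙ = λ a p → subst (P ∋_) (cong (_∷ _) (R.zeroʳ a)) (∋-⊙ P a p) }

  -- Gaussian elimination, one coordinate at a time. The slice at first coordinate 0 is coded
  -- recursively. A vector (1 , u) in `P`, if there is one, determines `w`; otherwise all first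
  -- coordinates in `P` vanish, since a nonzero one could be scaled to 1.
  code : ∀ {n} (P : DecSubspace n) → Σ (Code n) λ U → ⟪ U ⟫ ⊑ P × P ⊑ ⟪ U ⟫
  code {zero}  P = (0 , nil) , (λ { [] _ → ∋-𝟘 P }) , (λ { [] _ → refl })
  code {suc n} P with code (slice P) | any-member? (vectors n) (λ u → P ∋? (1# ∷ u))
  ... | (d , U) , sound , complete | yes (u , 1u∈P) = (suc d , new U w) , sound′ , complete′
    where
      w = ⊝ quotient U u
      shift : ∀ x v → quotient U (v ⊕ ⊝ (x ⊙ u)) ≡ quotient U v ⊕ x ⊙ w
      shift x v = trans (quotient-⊕ U _ _) (cong (quotient U v ⊕_)
        (trans (quotient-⊙ U (-F 1#) _) (trans (cong ⊝_ (quotient-⊙ U x u)) (sym (⊙-⊝ x _)))))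

      move : ∀ x v → (0# ∷ (v ⊕ ⊝ (x ⊙ u))) ⊕ x ⊙ (1# ∷ u) ≡ x ∷ v
      move x v = cong₂ _∷_ (trans (R.+-identityˡ _) (R.*-identityʳ x)) (⊕-⊝-cancel v (x ⊙ u))

      sound′ : ⟦ new U w ⟧ ⊑ P
      sound′ (x ∷ v) p = subst (P ∋_) (move x v) (∋-⊕ P (sound _ (trans (shift x v) p)) (∋-⊙ P x 1u∈P))

      complete′ : P ⊑ ⟦ new U w ⟧
      complete′ (x ∷ v) p = trans (sym (shift x v)) (complete _
        (subst (P ∋_) (trans (cong (_⊕ ⊝ (x ⊙ (1# ∷ u))) (sym (move x v))) (⊝-⊕-cancel _ _)) (∋-⊕ P p (∋-⊝ P (∋-⊙ P x 1u∈P)))))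
  ... | (d , U) , sound , complete | no none = (d , ext U) , sound′ , complete′
    where
      sound′ : ⟦ ext U ⟧ ⊑ P
      sound′ (x ∷ v) p = subst (λ y → P ∋ (y ∷ v)) (sym (Vecₚ.∷-injectiveˡ p)) (sound v (Vecₚ.∷-injectiveʳ p))

      complete′ : P ⊑ ⟦ ext U ⟧
      complete′ (x ∷ v) p with x ≟F 0#
      ... | yes refl = cong (0# ∷_) (complete v p)
      ... | no x≢0 = contradiction
        (proj₁ (inverse x x≢0) ⊙ v , subst (λ y → P ∋ (y ∷ proj₁ (inverse x x≢0) ⊙ v)) (trans (R.*-comm _ x) (proj₂ (inverse x x≢0))) (∋-⊙ P (proj₁ (inverse x x≢0)) p)) none

  -- The slices at first coordinate 0 give equal inner codes. A vector with first coordinate 1 tells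
  -- `ext` from `new`, and the vector (1 , section U (⊝ z)), lying in both `new` subspaces, forces
  -- `w` and `z` to agree.
  code-unique : ∀ {n} (U W : Code n) → ⟪ U ⟫ ⊑ ⟪ W ⟫ → ⟪ W ⟫ ⊑ ⟪ U ⟫ → U ≡ W
  code-unique (_ , nil)     (_ , nil)     _ _ = refl
  code-unique (_ , ext U)   (_ , ext W)   U⊑W W⊑U with code-unique (_ , U) (_ , W)
      (λ v p → Vecₚ.∷-injectiveʳ (U⊑W (0# ∷ v) (cong (0# ∷_) p)))
      (λ v p → Vecₚ.∷-injectiveʳ (W⊑U (0# ∷ v) (cong (0# ∷_) p)))
  ... | refl = refl
  code-unique (_ , ext U)   (_ , new W w) _ W⊑U = contradiction
    (sym (Vecₚ.∷-injectiveˡ (W⊑U (embed (new W w) (1# ∷ 𝟘)) (quotient-embed (new W w) (1# ∷ 𝟘))))) 0≢1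
  code-unique (_ , new U w) (_ , ext W)   U⊑W _ = contradiction
    (sym (Vecₚ.∷-injectiveˡ (U⊑W (embed (new U w) (1# ∷ 𝟘)) (quotient-embed (new U w) (1# ∷ 𝟘))))) 0≢1
  code-unique (_ , new U w) (_ , new W z) U⊑W W⊑U with code-unique (_ , U) (_ , W)
      (λ v p → drop W z v (U⊑W (0# ∷ v) (lift U w v p)))
      (λ v p → drop U w v (W⊑U (0# ∷ v) (lift W z v p)))
    where
      lift : ∀ {n d} (U : Sub n d) w v → ⟦ U ⟧ ∋ v → ⟦ new U w ⟧ ∋ (0# ∷ v)
      lift U w v p = trans (cong₂ _⊕_ p (⊙-zeroˡ w)) (⊕-identityʳ 𝟘)

      drop : ∀ {n d} (U : Sub n d) w v → ⟦ new U w ⟧ ∋ (0# ∷ v) → ⟦ U ⟧ ∋ v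
      drop U w v p = trans (sym (⊕-identityʳ _)) (trans (cong (quotient U v ⊕_) (sym (⊙-zeroˡ w))) p)
  ... | refl = cong (λ w → _ , new U w) (⊕⊝≡𝟘⇒≡ w z (trans (⊕-comm w (⊝ z))
      (trans (cong₂ _⊕_ (sym section-value) (sym (⊙-identity w))) (W⊑U (1# ∷ section U (⊝ z)) member))))
    where
      section-value : quotient U (section U (⊝ z)) ≡ ⊝ z
      section-value = quotient-section U (⊝ z)

      member : quotient U (section U (⊝ z)) ⊕ 1# ⊙ z ≡ 𝟘
      member = trans (cong₂ _⊕_ section-value (⊙-identity z)) (⊕-inverseˡ z)

  new-injective : ∀ {n d} {U U′ : Sub n d} {w w′} → new U w ≡ new U′ w′
    → Σ (U ≡ U′) λ eq → subst (λ U → Vec F (codim U)) eq w ≡ w′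
  new-injective refl = refl , refl

  sub-zero-unique : ∀ {n} (U W : Sub n 0) → U ≡ W
  sub-zero-unique nil     nil     = refl
  sub-zero-unique (ext U) (ext W) = cong ext (sub-zero-unique U W)

  zero-sub : ∀ n → Sub n 0
  zero-sub zero    = nil
  zero-sub (suc n) = ext (zero-sub n)

  zero-sub-least : ∀ {n} (P : DecSubspace n) → _⊑_ (⟦_⟧ (zero-sub n)) P
  zero-sub-least {n} P v p with embed-onto (zero-sub n) v p
  ... | [] , refl = subst (P ∋_) (sym (embed-𝟘 (zero-sub n))) (∋-𝟘 P)

  -- The constructors `ext` and `new` match the two summands of `#subspaces`; the parameter of a
  -- `new` has codim U = n - d coordinates, hence the factor q^(n-d).
  subs : ∀ n d → Card (λ (_ : Sub n d) → ⊤) (#subspaces q n d)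
  subs n zero = record
    { elem = λ _ → zero-sub n ; elem∈ = λ _ → tt ; injective = λ { Fin.zero Fin.zero _ → refl }
    ; index = λ _ _ → Fin.zero ; elem-index = λ U _ → sub-zero-unique _ U }
  subs zero (suc d) = record
    { elem = λ () ; elem∈ = λ () ; injective = λ () ; index = λ () ; elem-index = λ () }
  subs (suc n) (suc d) = card-map f (λ _ _ → tt) f-inj f-onto (card-⊎ (subs n (suc d)) (card-× (vectors (n ∸ d)) (subs n d)))
    where
      cast : ∀ (U : Sub n d) → Vec F (n ∸ d) → Vec F (codim U)
      cast U = subst (Vec F) (sym (codim≡ U))

      f : Sub n (suc d) ⊎ (Vec F (n ∸ d) × Sub n d) → Sub (suc n) (suc d)
      f (inj₁ U)       = ext U
      f (inj₂ (w , U)) = new U (cast U w)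

      f-inj : ∀ x y → f x ≡ f y → x ≡ y
      f-inj (inj₁ U)       (inj₁ _)         refl = refl
      f-inj (inj₂ (w , U)) (inj₂ (w′ , U′)) eq with new-injective eq
      ... | refl , eq′ = cong (λ w → inj₂ (w , U)) (subst-injective (sym (codim≡ U)) eq′)

      f-onto : ∀ W → ⊤ → ∃ λ x → [ (λ _ → ⊤) , (λ _ → ⊤ × ⊤) ]′ x × f x ≡ W
      f-onto (ext U)   _ = inj₁ U , tt , refl
      f-onto (new U w) _ = inj₂ (subst (Vec F) (codim≡ U) w , U) , (tt , tt) , cong (new U) (subst-sym-subst (codim≡ U))

  codes< : ∀ n k → Card (λ (U : Code n) → dimension U < k) (#subspaces< q n k)
  codes< n zero = record
    { elem = λ () ; elem∈ = λ () ; injective = λ () ; index = λ _ () ; elem-index = λ _ () }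
  codes< n (suc k) = card-map f f∈ f-inj f-onto (card-⊎ {Q = λ U → dimension (proj₁ U) < k} (subs n k) restricted)
    where
      -- Carrying the bound keeps f injective; without it, codes of dimension k would be hit twice.
      restricted : Card {Σ (Code n) λ U → dimension U < k} (λ U → dimension (proj₁ U) < k) (#subspaces< q n k)
      restricted = record
        { elem = λ i → elem (codes< n k) i , elem∈ (codes< n k) i
        ; elem∈ = elem∈ (codes< n k)
        ; injective = λ i j eq → injective (codes< n k) i j (cong proj₁ eq)
        ; index = λ U p → index (codes< n k) (proj₁ U) p
        ; elem-index = λ U p → pair≡ (elem-index (codes< n k) (proj₁ U) p) }
        where
          pair≡ : ∀ {U W : Code n} {p : dimension U < k} {r : dimension W < k} → U ≡ W → (U , p) ≡ (W , r)
          pair≡ refl = cong (_ ,_) (ℕₚ.<-irrelevant _ _)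

      f : Sub n k ⊎ (Σ (Code n) λ U → dimension U < k) → Code n
      f (inj₁ U) = k , U
      f (inj₂ U) = proj₁ U

      f∈ : ∀ x → _ → dimension (f x) < suc k
      f∈ (inj₁ U) _ = ℕₚ.≤-refl
      f∈ (inj₂ U) _ = ℕₚ.m<n⇒m<1+n (proj₂ U)

      f-inj : ∀ x y → f x ≡ f y → x ≡ y
      f-inj (inj₁ U)       (inj₁ _)       refl = refl
      f-inj (inj₁ U)       (inj₂ (_ , p)) refl = contradiction p (ℕₚ.<-irrefl refl)
      f-inj (inj₂ (_ , p)) (inj₁ U)       refl = contradiction p (ℕₚ.<-irrefl refl)
      f-inj (inj₂ (U , p)) (inj₂ (_ , r)) refl = cong (λ p → inj₂ (U , p)) (ℕₚ.<-irrelevant p r)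

      f-onto : ∀ U → dimension U < suc k → ∃ λ x → [ (λ _ → ⊤) , (λ U → dimension (proj₁ U) < k) ]′ x × f x ≡ U
      f-onto (d , U) (s≤s d≤k) with d ℕₚ.≟ k
      ... | yes refl = inj₁ U , tt , refl
      ... | no d≢k   = inj₂ ((d , U) , ℕₚ.≤∧≢⇒< d≤k d≢k) , ℕₚ.≤∧≢⇒< d≤k d≢k , refl

  -- Dimension, intersections and sums

  dim : ∀ {n} → DecSubspace n → ℕ
  dim P = dimension (proj₁ (code P))

  card-dim : ∀ {n} (P : DecSubspace n) → Card (P ∋_) (q ^ dim P)
  card-dim P with code P
  ... | (_ , U) , U⊑P , P⊑U = card-resp U⊑P P⊑U (card-⟦⟧ U)

  dim-unique : ∀ {n d} (P : DecSubspace n) {Q : Vec F n → Set} → Card Q (q ^ d)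
    → (∀ v → P ∋ v → Q v) → (∀ v → Q v → P ∋ v) → dim P ≡ d
  dim-unique P D P⊆Q Q⊆P = q^-injective 2≤q (card-unique (card-dim P) D P⊆Q Q⊆P)

  dim-⟪⟫ : ∀ {n} (U : Code n) → dim ⟪ U ⟫ ≡ dimension U
  dim-⟪⟫ (_ , U) = dim-unique ⟦ U ⟧ (card-⟦⟧ U) (λ _ p → p) (λ _ p → p)

  dim-mono : ∀ {n} {P Q : DecSubspace n} → P ⊑ Q → dim P ≤ dim Q
  dim-mono {P = P} {Q} P⊑Q = q^-cancel-≤ 2≤q (card-⊆ (card-dim P) (card-dim Q) P⊑Q)

  dim-cong : ∀ {n} {P Q : DecSubspace n} → P ⊑ Q → Q ⊑ P → dim P ≡ dim Q
  dim-cong {P = P} {Q} P⊑Q Q⊑P = ℕₚ.≤-antisym (dim-mono {P = P} {Q} P⊑Q) (dim-mono {P = Q} {P} Q⊑P)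

  ⊑-by-dim : ∀ {n} {P Q : DecSubspace n} → P ⊑ Q → dim Q ≤ dim P → Q ⊑ P
  ⊑-by-dim {P = P} {Q} P⊑Q le = card-full (card-dim P) (card-dim Q) (P ∋?_) P⊑Q
    (ℕₚ.^-monoʳ-≤ q {{>-nonZero (ℕₚ.≤-trans (s≤s z≤n) 2≤q)}} le)

  code≡ : ∀ {n} {U W : Code n} → ⟪ U ⟫ ⊑ ⟪ W ⟫ → dimension W ≤ dimension U → U ≡ W
  code≡ {U = U} {W} U⊑W le = code-unique U W U⊑W
    (⊑-by-dim {P = ⟪ U ⟫} {⟪ W ⟫} U⊑W (subst₂ _≤_ (sym (dim-⟪⟫ W)) (sym (dim-⟪⟫ U)) le))

  infixr 7 _⊓_
  _⊓_ : ∀ {n} → DecSubspace n → DecSubspace n → DecSubspace n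
  P ⊓ Q = record
    { _∋_ = λ v → P ∋ v × Q ∋ v ; _∋?_ = λ v → (P ∋? v) Decidable.×-dec (Q ∋? v) ; ∋-𝟘 = ∋-𝟘 P , ∋-𝟘 Q
    ; ∋-⊕ = λ (p , r) (p′ , r′) → ∋-⊕ P p p′ , ∋-⊕ Q r r′
    ; ∋-⊙ = λ a (p , r) → ∋-⊙ P a p , ∋-⊙ Q a r }

  infixr 6 _⊞_
  _⊞_ : ∀ {n} → DecSubspace n → DecSubspace n → DecSubspace n
  P ⊞ Q = record
    { _∋_ = λ v → ∃ λ u → P ∋ u × Q ∋ (v ⊕ ⊝ u)
    ; _∋?_ = λ v → any-member? (vectors _) λ u → (P ∋? u) Decidable.×-dec (Q ∋? (v ⊕ ⊝ u))
    ; ∋-𝟘 = 𝟘 , ∋-𝟘 P , subst (Q ∋_) (sym (⊕-inverseʳ 𝟘)) (∋-𝟘 Q)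
    ; ∋-⊕ = λ {v} {v′} (u , p , r) (u′ , p′ , r′) → u ⊕ u′ , ∋-⊕ P p p′ , subst (Q ∋_)
        (trans (⊕-interchange v (⊝ u) v′ (⊝ u′)) (cong (v ⊕ v′ ⊕_) (sym (⊙-distribˡ (-F 1#) u u′)))) (∋-⊕ Q r r′)
    ; ∋-⊙ = λ a {v} (u , p , r) → a ⊙ u , ∋-⊙ P a p , subst (Q ∋_)
        (trans (⊙-distribˡ a v (⊝ u)) (cong (a ⊙ v ⊕_) (⊙-⊝ a u))) (∋-⊙ Q a r) }

  ⊞-upperˡ : ∀ {n} (P Q : DecSubspace n) → P ⊑ P ⊞ Q
  ⊞-upperˡ P Q v p = v , p , subst (Q ∋_) (sym (⊕-inverseʳ v)) (∋-𝟘 Q)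

  ⊞-upperʳ : ∀ {n} (P Q : DecSubspace n) → Q ⊑ P ⊞ Q
  ⊞-upperʳ P Q v r = 𝟘 , ∋-𝟘 P , subst (Q ∋_) (sym (trans (cong (v ⊕_) (⊙-zeroʳ (-F 1#))) (⊕-identityʳ v))) r

  ⊞-least : ∀ {n} (P Q R : DecSubspace n) → P ⊑ R → Q ⊑ R → P ⊞ Q ⊑ R
  ⊞-least P Q R P⊑R Q⊑R v (u , p , r) = subst (R ∋_) (⊕-⊝-cancel v u) (∋-⊕ R (Q⊑R _ r) (P⊑R _ p))

  -- A pair (v , z), with v = u + (v - u) and z in the intersection, goes to (u + z , v - u - z).
  -- The sum of the components returns v; then u is known and the first component returns z.
  dim-⊞ : ∀ {n} (P Q : DecSubspace n) → dim (P ⊞ Q) + dim (P ⊓ Q) ≤ dim P + dim Q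
  dim-⊞ P Q = q^-cancel-≤ 2≤q (subst₂ _≤_ (sym (ℕₚ.^-distribˡ-+-* q (dim (P ⊞ Q)) _)) (sym (ℕₚ.^-distribˡ-+-* q (dim P) _))
    (card-×-≤ (card-dim (P ⊞ Q)) (card-dim (P ⊓ Q)) (card-dim P) (card-dim Q)
      (λ v (u , _ , _) z _ → (u ⊕ z) , (v ⊕ ⊝ u) ⊕ ⊝ z)
      (λ v (u , p , r) z (zp , zr) → ∋-⊕ P p zp , ∋-⊕ Q r (∋-⊝ Q zr))
      (λ {v} {(u , _)} {z} {_} {v′} {(u′ , _)} {z′} eq → trans (sym (total v u z)) (trans (cong (λ (x , y) → y ⊕ x) eq) (total v′ u′ z′)))
      (λ {v} {(u , _)} {z} {_} {z′} eq → ⊕-cancelʳ u _ _ (trans (⊕-comm z u) (trans (cong proj₁ eq) (⊕-comm u z′))))))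
    where
      total : ∀ {n} (v u z : Vec F n) → ((v ⊕ ⊝ u) ⊕ ⊝ z) ⊕ (u ⊕ z) ≡ v
      total v u z = trans (cong ((v ⊕ ⊝ u) ⊕ ⊝ z ⊕_) (⊕-comm u z))
        (trans (sym (⊕-assoc _ z u)) (trans (cong (_⊕ u) (⊕-⊝-cancel (v ⊕ ⊝ u) z)) (⊕-⊝-cancel v u)))

  line : ∀ {n} → Vec F n → DecSubspace n
  line v = record
    { _∋_ = λ x → ∃ λ a → a ⊙ v ≡ x
    ; _∋?_ = λ x → any-member? scalars λ a → (a ⊙ v) ≟V x
    ; ∋-𝟘 = 0# , ⊙-zeroˡ v
    ; ∋-⊕ = λ { (a , refl) (b , refl) → a +F b , ⊙-distribʳ a b v }
    ; ∋-⊙ = λ { b (a , refl) → b *F a , ⊙-assoc b a v } }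

  dim-line : ∀ {n} (v : Vec F n) → dim (line v) ≤ 1
  dim-line v = q^-cancel-≤ 2≤q (subst (q ^ dim (line v) ≤_) (sym (ℕₚ.*-identityʳ q))
    (card-≤ (card-dim (line v)) scalars (λ _ → proj₁) (λ _ _ → tt)
      (λ _ _ (_ , eq) (_ , eq′) a≡b → trans (sym eq) (trans (cong (_⊙ v) a≡b) eq′))))

  line-least : ∀ {n} (v : Vec F n) (P : DecSubspace n) → P ∋ v → line v ⊑ P
  line-least v P p _ (a , refl) = ∋-⊙ P a p

  line-∋ : ∀ {n} (v : Vec F n) → line v ∋ v
  line-∋ v = 1# , ⊙-identity v

  adjoin : ∀ {n} → Code n → Vec F n → Code n
  adjoin U v = proj₁ (code (⟪ U ⟫ ⊞ line v))

  dimension-adjoin : ∀ {n} (U : Code n) v → dimension (adjoin U v) ≤ suc (dimension U)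
  dimension-adjoin U v = ℕₚ.≤-trans (ℕₚ.m≤m+n _ _) (ℕₚ.≤-trans (dim-⊞ ⟪ U ⟫ (line v))
    (ℕₚ.≤-trans (ℕₚ.+-monoʳ-≤ (dim ⟪ U ⟫) (dim-line v))
      (ℕₚ.≤-reflexive (trans (ℕₚ.+-comm (dim ⟪ U ⟫) 1) (cong suc (dim-⟪⟫ U))))))

  adjoin-⊑⇒ : ∀ {n} (U : Code n) v (P : DecSubspace n) → ⟪ adjoin U v ⟫ ⊑ P → ⟪ U ⟫ ⊑ P × P ∋ v
  adjoin-⊑⇒ U v P below = (λ x p → below x (up x (⊞-upperˡ ⟪ U ⟫ (line v) x p)))
                        , below v (up v (⊞-upperʳ ⟪ U ⟫ (line v) v (line-∋ v)))
    where up = proj₂ (proj₂ (code (⟪ U ⟫ ⊞ line v)))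

  adjoin-⊑⇐ : ∀ {n} (U : Code n) v (P : DecSubspace n) → ⟪ U ⟫ ⊑ P → P ∋ v → ⟪ adjoin U v ⟫ ⊑ P
  adjoin-⊑⇐ U v P U⊑P p x r = ⊞-least ⟪ U ⟫ (line v) P U⊑P (line-least v P p) x
    (proj₁ (proj₂ (code (⟪ U ⟫ ⊞ line v))) x r)

  -- Functions of bounded degree on subspaces

  ⟨_⊑_⟩ : ∀ {n} → Code n → Code n → ℤ
  ⟨ U ⊑ X ⟩ = + indicator (⟪ U ⟫ ⊑? ⟪ X ⟫)

  -- x_U = ⟨ U ⊑_⟩ plays the role of the multilinear monomial of degree dim U.
  data Degree≤ {n} (k : ℕ) : (Code n → ℤ) → Set where
    monomial : ∀ U → dimension U ≤ k → Degree≤ k ⟨ U ⊑_⟩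
    zero     : Degree≤ k (λ _ → 0ℤ)
    plus     : ∀ {f g} → Degree≤ k f → Degree≤ k g → Degree≤ k (λ X → f X +ℤ g X)
    scale    : ∀ c {f} → Degree≤ k f → Degree≤ k (λ X → c *ℤ f X)
    -- Closure under pointwise equality takes the place of function extensionality.
    pointwise     : ∀ {f g} → (∀ X → f X ≡ g X) → Degree≤ k f → Degree≤ k g

  degree-mono : ∀ {n k l} {f : Code n → ℤ} → k ≤ l → Degree≤ k f → Degree≤ l f
  degree-mono k≤l (monomial U d≤k) = monomial U (ℕₚ.≤-trans d≤k k≤l)
  degree-mono k≤l zero             = zero
  degree-mono k≤l (plus f g)       = plus (degree-mono k≤l f) (degree-mono k≤l g)
  degree-mono k≤l (scale c f)      = scale c (degree-mono k≤l f)
  degree-mono k≤l (pointwise eq f)      = pointwise eq (degree-mono k≤l f)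

  -- Degree at most one, stated as the effect of multiplication, so that products are built one
  -- linear factor at a time.
  Linear : ∀ {n} → (Code n → ℤ) → Set
  Linear φ = ∀ {k f} → Degree≤ k f → Degree≤ (suc k) (λ X → f X *ℤ φ X)

  indicator-× : ∀ {A B C : Set} (A? : Dec A) (B? : Dec B) (C? : Dec C) → (C → A × B) → (A → B → C)
    → + indicator C? ≡ + indicator A? *ℤ + indicator B?
  indicator-× (yes a) (yes b) C? to from = cong +_ (indicator-yes C? (from a b))
  indicator-× (yes a) (no ¬b) C? to from = cong +_ (indicator-no C? (λ c → ¬b (proj₂ (to c))))
  indicator-× (no ¬a) B?      C? to from = cong +_ (indicator-no C? (λ c → ¬a (proj₁ (to c))))

  -- X contains both U and v iff it contains `adjoin U v`, so the product of x_U with the indicator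
  -- is again a monomial.
  linear-∋ : ∀ {n} (v : Vec F n) → Linear (λ X → + indicator (⟪ X ⟫ ∋? v))
  linear-∋ v (monomial U d≤k) = pointwise
    (λ X → indicator-× (⟪ U ⟫ ⊑? ⟪ X ⟫) (⟪ X ⟫ ∋? v) (⟪ adjoin U v ⟫ ⊑? ⟪ X ⟫) (adjoin-⊑⇒ U v ⟪ X ⟫) (adjoin-⊑⇐ U v ⟪ X ⟫))
    (monomial (adjoin U v) (ℕₚ.≤-trans (dimension-adjoin U v) (s≤s d≤k)))
  linear-∋ v zero = zero
  linear-∋ v (plus {f} {g} p r) = pointwise (λ X → sym (ℤₚ.*-distribʳ-+ (+ indicator (⟪ X ⟫ ∋? v)) (f X) (g X)))
    (plus (linear-∋ v p) (linear-∋ v r))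
  linear-∋ v (scale c {f} p) = pointwise (λ X → sym (ℤₚ.*-assoc c (f X) (+ indicator (⟪ X ⟫ ∋? v)))) (scale c (linear-∋ v p))
  linear-∋ v (pointwise eq p) = pointwise (λ X → cong (_*ℤ + indicator (⟪ X ⟫ ∋? v)) (eq X)) (linear-∋ v p)

  linear-const : ∀ {n} c → Linear {n} (λ _ → c)
  linear-const c {f = f} p = pointwise (λ X → ℤₚ.*-comm c (f X)) (scale c (degree-mono (ℕₚ.n≤1+n _) p))

  linear-+ : ∀ {n} {φ ψ : Code n → ℤ} → Linear φ → Linear ψ → Linear (λ X → φ X +ℤ ψ X)
  linear-+ {φ = φ} {ψ} lφ lψ {f = f} p = pointwise (λ X → sym (ℤₚ.*-distribˡ-+ (f X) (φ X) (ψ X))) (plus (lφ p) (lψ p))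

  linear-count : ∀ {n N} (vs : Fin N → Vec F n) → Linear (λ X → + count (λ i → ⟪ X ⟫ ∋? vs i))
  linear-count {N = zero}  vs = linear-const 0ℤ
  linear-count {N = suc N} vs = linear-+ (linear-∋ (vs Fin.zero)) (linear-count (λ i → vs (Fin.suc i)))

  linear-product : ∀ {n s} (φ : Fin s → Code n → ℤ) → (∀ a → Linear (φ a)) → ∀ {k f}
    → Degree≤ k f → Degree≤ (k + s) (λ X → f X *ℤ product (λ a → φ a X))
  linear-product {s = zero} φ lφ {k} {f} p = degree-mono (ℕₚ.≤-reflexive (sym (ℕₚ.+-identityʳ k)))
    (pointwise (λ X → sym (ℤₚ.*-identityʳ (f X))) p)
  linear-product {s = suc s} φ lφ {k} {f} p = degree-mono (ℕₚ.≤-reflexive (sym (ℕₚ.+-suc k s)))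
    (pointwise (λ X → ℤₚ.*-assoc (f X) (φ Fin.zero X) _)
      (linear-product (λ a → φ (Fin.suc a)) (λ a → lφ (Fin.suc a)) (lφ Fin.zero p)))

  -- The product starts from the constant 1, which is the monomial of the zero subspace.
  degree-product : ∀ {n s} (φ : Fin s → Code n → ℤ) → (∀ a → Linear (φ a)) → Degree≤ s (λ X → product (λ a → φ a X))
  degree-product {n} φ lφ = pointwise (λ X → trans (cong (λ z → + z *ℤ product (λ a → φ a X))
      (indicator-yes (⟪ 0 , zero-sub n ⟫ ⊑? ⟪ X ⟫) (zero-sub-least ⟪ X ⟫))) (ℤₚ.*-identityˡ _))
    (linear-product φ lφ (monomial (0 , zero-sub n) z≤n))

  -- The monomials of degree at most `s` are the spanning functions required by `triangular-bound`;
  -- their number is what limits the family.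
  expand : ∀ {n s} {f : Code n → ℤ} → Degree≤ s f
    → Σ (Fin (#subspaces< q n (suc s)) → ℤ) λ c → ∀ X → f X ≡ sum (λ k → c k *ℤ ⟨ elem (codes< n (suc s)) k ⊑ X ⟩)
  expand {n} {s} (monomial U d≤s) = δ , λ X → sym (begin
      sum (λ k → δ k *ℤ ⟨ elem B k ⊑ X ⟩)
        ≡⟨ sum-single _ u (λ j j≢u → trans (cong (λ z → + z *ℤ ⟨ elem B j ⊑ X ⟩) (indicator-no (j Finₚ.≟ u) j≢u)) (ℤₚ.*-zeroˡ ⟨ elem B j ⊑ X ⟩)) ⟩
      δ u *ℤ ⟨ elem B u ⊑ X ⟩
        ≡⟨ cong (λ z → + z *ℤ ⟨ elem B u ⊑ X ⟩) (indicator-yes (u Finₚ.≟ u) refl) ⟩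
      1ℤ *ℤ ⟨ elem B u ⊑ X ⟩
        ≡⟨ ℤₚ.*-identityˡ _ ⟩
      ⟨ elem B u ⊑ X ⟩
        ≡⟨ cong ⟨_⊑ X ⟩ (elem-index B U (s≤s d≤s)) ⟩
      ⟨ U ⊑ X ⟩ ∎)
    where
      open ≡-Reasoning
      B = codes< n (suc s)

      u : Fin (#subspaces< q n (suc s))
      u = index B U (s≤s d≤s)

      δ : Fin (#subspaces< q n (suc s)) → ℤ
      δ k = + indicator (k Finₚ.≟ u)
  expand {n} {s} zero = (λ _ → 0ℤ) , λ X → sym (sum-zero λ k → ℤₚ.*-zeroˡ ⟨ elem (codes< n (suc s)) k ⊑ X ⟩)
  expand {n} {s} (plus p r) with expand p | expand r
  ... | c , eq | d , eq′ = (λ k → c k +ℤ d k) , λ X → trans (cong₂ _+ℤ_ (eq X) (eq′ X))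
    (trans (sym (∑-distrib-+ (λ k → c k *ℤ x X k) (λ k → d k *ℤ x X k))) (sum-cong-≗ λ k → sym (ℤₚ.*-distribʳ-+ (x X k) (c k) (d k))))
    where
      x : Code n → Fin _ → ℤ
      x X k = ⟨ elem (codes< n (suc s)) k ⊑ X ⟩
  expand {n} {s} (scale a p) with expand p
  ... | c , eq = (λ k → a *ℤ c k) , λ X → trans (cong (a *ℤ_) (eq X))
    (trans (*-distribˡ-sum a (λ k → c k *ℤ x X k)) (sum-cong-≗ λ k → sym (ℤₚ.*-assoc a (c k) (x X k))))
    where
      x : Code n → Fin _ → ℤ
      x X k = ⟨ elem (codes< n (suc s)) k ⊑ X ⟩
  expand (pointwise eq p) with expand p
  ... | c , eq′ = c , λ X → trans (sym (eq X)) (eq′ X)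

  -- The Alon-Babai-Suzuki bound

  count-dim : ∀ {n N} (P : DecSubspace n) (A : Card (P ∋_) N) (X : Code n)
    → count (λ i → ⟪ X ⟫ ∋? elem A i) ≡ q ^ dim (P ⊓ ⟪ X ⟫)
  count-dim P A X = card-unique
    (card-restrict {Q = ⟪ X ⟫ ∋_} A (card-count (λ i → ⟪ X ⟫ ∋? elem A i)) (λ eq → subst (⟪ X ⟫ ∋_) eq))
    (card-dim (P ⊓ ⟪ X ⟫)) (λ _ p → p) (λ _ p → p)

  -- The function |P ∩ X| - q^l of X, with the cardinality written as a count over the vectors of
  -- `P` so that its linearity is visible.
  difference : ∀ {n} → DecSubspace n → ℕ → Code n → ℤ
  difference P l X = + count (λ i → ⟪ X ⟫ ∋? elem (card-dim P) i) +ℤ negℤ (+ (q ^ l))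

  linear-difference : ∀ {n} (P : DecSubspace n) l → Linear (difference P l)
  linear-difference P l = linear-+ (linear-count (elem (card-dim P))) (linear-const (negℤ (+ (q ^ l))))

  difference-zero : ∀ {n} (P : DecSubspace n) {l} X → dim (P ⊓ ⟪ X ⟫) ≡ l → difference P l X ≡ 0ℤ
  difference-zero P X refl = trans (cong (λ z → + z +ℤ negℤ (+ (q ^ dim (P ⊓ ⟪ X ⟫)))) (count-dim P (card-dim P) X)) (ℤₚ.+-inverseʳ (+ (q ^ dim (P ⊓ ⟪ X ⟫))))

  difference-nonzero : ∀ {n} (P : DecSubspace n) {l} X → dim (P ⊓ ⟪ X ⟫) ≢ l → difference P l X ≢ 0ℤ
  difference-nonzero P X ≢l eq = ≢l (q^-injective 2≤q
    (trans (sym (count-dim P (card-dim P) X)) (ℤₚ.+-injective (ℤₚ.i-j≡0⇒i≡j _ _ eq))))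

  whole : ∀ n → DecSubspace n
  whole n = record
    { _∋_ = λ _ → ⊤ ; _∋?_ = λ _ → yes tt ; ∋-𝟘 = tt ; ∋-⊕ = λ _ _ → tt ; ∋-⊙ = λ _ _ → tt }

  dim-whole-⊓ : ∀ {n} (U : Code n) → dim (whole n ⊓ ⟪ U ⟫) ≡ dimension U
  dim-whole-⊓ {n} U = trans (dim-cong {P = whole n ⊓ ⟪ U ⟫} {⟪ U ⟫} (λ _ → proj₂) (λ _ p → tt , p)) (dim-⟪⟫ U)

  -- Alon, Babai and Suzuki: the functions ∏ (|U ∩ X| - q^l) over l ∈ L, l ≠ dim U, for U in the family,
  -- and x_U ∏ (|X| - q^k) over k ∈ K, for dim U ≤ s - r, are independent and of degree at most s.
  intersection-bound : ∀ n s (L : Fin s → ℕ) r (K : Fin r → ℕ) m (W : Fin m → Code n)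
    → (∀ i j → W i ≡ W j → i ≡ j)
    → (∀ i j → i ≢ j → ∃ λ a → dim (⟪ W i ⟫ ⊓ ⟪ W j ⟫) ≡ L a)
    → (∀ i → ∃ λ a → dimension (W i) ≡ K a)
    → (∀ a → s < K a + r)
    → m ≤ bound q n s r
  intersection-bound n s L r K m W W-inj meets sizes large = ℕₚ.+-cancelʳ-≤ (#subspaces< q n (suc s ∸ r)) _ _
    (ℕₚ.≤-trans total (ℕₚ.≤-reflexive (sym (bound-telescope (#subspaces< q n) n s r
      λ j → cong (_+ #subspaces< q n j) (sym (gauss≡#subspaces 2≤q n j))))))
    where
      I : Set
      I = Fin m ⊎ Code n

      point : I → Code n
      point = [ W , (λ U → U) ]′

      -- The offset `suc n` puts the auxiliary indices above all members: auxiliary functions vanish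
      -- at every member through a size factor, while nothing is claimed about the member functions
      -- at auxiliary points.
      rank : I → ℕ
      rank (inj₁ i) = dimension (W i)
      rank (inj₂ U) = suc n + dimension U

      -- The factor for l = dim W_i would vanish at `W i` itself and is replaced by 1. The decision
      -- is an argument, so that the lemmas below can match on it.
      factor : ∀ i l → Dec (dimension (W i) ≡ l) → Code n → ℤ
      factor i l (yes _) X = 1ℤ
      factor i l (no _)  X = difference ⟪ W i ⟫ l X

      factors : ∀ i → Fin s → Code n → ℤ
      factors i a = factor i (L a) (dimension (W i) ℕₚ.≟ L a)

      linear-factor : ∀ i l d → Linear (factor i l d)
      linear-factor i l (yes _) = linear-const 1ℤ
      linear-factor i l (no _)  = linear-difference ⟪ W i ⟫ l

      factor-nonzero : ∀ i l d → factor i l d (W i) ≢ 0ℤ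
      factor-nonzero i l (yes _) ()
      factor-nonzero i l (no d≢l) = difference-nonzero ⟪ W i ⟫ (W i) λ eq → d≢l
        (trans (sym (dim-⟪⟫ (W i))) (trans (dim-cong {P = ⟪ W i ⟫} {⟪ W i ⟫ ⊓ ⟪ W i ⟫} (λ _ p → p , p) (λ _ → proj₁)) eq))

      -- The order by dimension makes up for the omitted factor: an intersection of dimension dim
      -- W_i means that W_i lies in W_j, and then the two are equal.
      factor-zero : ∀ i j l d → i ≢ j → dimension (W j) ≤ dimension (W i) → dim (⟪ W i ⟫ ⊓ ⟪ W j ⟫) ≡ l → factor i l d (W j) ≡ 0ℤ
      factor-zero i j l (no _)    i≢j le eq = difference-zero ⟪ W i ⟫ (W j) eq
      factor-zero i j l (yes d≡l) i≢j le eq = contradiction (W-inj i j (code≡ Wi⊑Wj le)) i≢j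
        where
          Wi⊑Wj : ⟪ W i ⟫ ⊑ ⟪ W j ⟫
          Wi⊑Wj v p = proj₂ (⊑-by-dim {P = ⟪ W i ⟫ ⊓ ⟪ W j ⟫} {⟪ W i ⟫} (λ _ → proj₁)
            (ℕₚ.≤-reflexive (trans (dim-⟪⟫ (W i)) (trans d≡l (sym eq)))) v p)

      sizeFactors : Fin r → Code n → ℤ
      sizeFactors a = difference (whole n) (K a)

      h : I → Code n → ℤ
      h (inj₁ i) X = product (λ a → factors i a X)
      h (inj₂ U) X = ⟨ U ⊑ X ⟩ *ℤ product (λ a → sizeFactors a X)

      Low : I → Set
      Low = [ (λ _ → ⊤) , (λ U → dimension U < suc s ∸ r) ]′

      -- For r > s + 1 the truncated difference would hide the sign; it is 0 then, and no `U`
      -- qualifies.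
      low : ∀ (U : Code n) → dimension U < suc s ∸ r → dimension U + r ≤ s
      low U d< = ℕₚ.≤-pred (ℕₚ.m≤o∸n⇒m+n≤o (suc (dimension U)) r≤1+s d<)
        where
          r≤1+s : r ≤ suc s
          r≤1+s = ℕₚ.≮⇒≥ λ s<r → ℕₚ.n≮0 (subst (dimension U <_) (ℕₚ.m≤n⇒m∸n≡0 (ℕₚ.<⇒≤ s<r)) d<)

      degree : ∀ x → Low x → Degree≤ s (h x)
      degree (inj₁ i) _  = degree-product (factors i) (λ a → linear-factor i (L a) (dimension (W i) ℕₚ.≟ L a))
      degree (inj₂ U) d< = degree-mono (low U d<)
        (linear-product sizeFactors (λ a → linear-difference (whole n) (K a)) (monomial U ℕₚ.≤-refl))

      diagonal : ∀ x → Low x → h x (point x) ≢ 0ℤ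
      diagonal (inj₁ i) _ = product-nonzero _ λ a → factor-nonzero i (L a) (dimension (W i) ℕₚ.≟ L a)
      diagonal (inj₂ U) d< eq = [ (λ eq → contradiction (trans (cong +_ (sym (indicator-yes (⟪ U ⟫ ⊑? ⟪ U ⟫) λ _ p → p))) eq) λ ())
                                , product-nonzero _ (λ a → difference-nonzero (whole n) U (differs a)) ]′
          (ℤₚ.i*j≡0⇒i≡0∨j≡0 ⟨ U ⊑ U ⟩ eq)
        where
          -- The lower bound on the sizes enters here: dim U + r ≤ s < K a + r.
          differs : ∀ a → dim (whole n ⊓ ⟪ U ⟫) ≢ K a
          differs a eq = ℕₚ.<⇒≱ (large a) (subst (λ k → k + r ≤ s) (trans (sym (dim-whole-⊓ U)) eq) (low U d<))

      lower : ∀ x y → x ≢ y → rank y ≤ rank x → h x (point y) ≡ 0ℤ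
      lower (inj₁ i) (inj₁ j) x≢y le with meets i j (λ i≡j → x≢y (cong inj₁ i≡j))
      ... | a , eq = product-zero _ a (factor-zero i j (L a) (dimension (W i) ℕₚ.≟ L a) (λ i≡j → x≢y (cong inj₁ i≡j)) le eq)
      lower (inj₁ i) (inj₂ U) x≢y le = contradiction (ℕₚ.≤-trans (ℕₚ.m≤m+n (suc n) _) le) (ℕₚ.≤⇒≯ (dim≤ (proj₂ (W i))))
      lower (inj₂ U) (inj₁ j) x≢y le with sizes j
      ... | a , eq = trans (cong (⟨ U ⊑ W j ⟩ *ℤ_) (product-zero _ a (difference-zero (whole n) (W j) (trans (dim-whole-⊓ (W j)) eq)))) (ℤₚ.*-zeroʳ ⟨ U ⊑ W j ⟩)
      lower (inj₂ U) (inj₂ X) x≢y le = cong (λ z → + z *ℤ product (λ a → sizeFactors a X))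
        (indicator-no (⟪ U ⟫ ⊑? ⟪ X ⟫) λ U⊑X → x≢y (cong inj₂ (code≡ U⊑X (ℕₚ.+-cancelˡ-≤ (suc n) _ _ le))))

      indices : Card Low (m + #subspaces< q n (suc s ∸ r))
      indices = card-⊎ (card-Fin m) (codes< n (suc s ∸ r))

      total : m + #subspaces< q n (suc s ∸ r) ≤ #subspaces< q n (suc s)
      total = triangular-bound (λ i → h (elem indices i)) (λ i → point (elem indices i)) (λ i → rank (elem indices i))
        (λ k X → ⟨ elem (codes< n (suc s)) k ⊑ X ⟩)
        (λ i → proj₁ (expand (degree (elem indices i) (elem∈ indices i))))
        (λ i → proj₂ (expand (degree (elem indices i) (elem∈ indices i))))
        (λ i → diagonal (elem indices i) (elem∈ indices i))
        (λ i j i≢j → lower (elem indices i) (elem indices j) (λ eq → i≢j (injective indices i j eq)))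

  -- Quotients by a subspace

  infixl 7 _/_
  -- Intended for `P` containing `A`: `P` is then a union of cosets of `A`, so testing the
  -- representative given by `section` decides whether the coset lies in `P`.
  _/_ : ∀ {n e} → DecSubspace n → (A : Sub n e) → DecSubspace (codim A)
  P / A = record
    { _∋_ = λ w → P ∋ section A w ; _∋?_ = λ w → P ∋? section A w ; ∋-𝟘 = subst (P ∋_) (sym (section-𝟘 A)) (∋-𝟘 P)
    ; ∋-⊕ = λ p r → subst (P ∋_) (sym (section-⊕ A _ _)) (∋-⊕ P p r)
    ; ∋-⊙ = λ a p → subst (P ∋_) (sym (section-⊙ A a _)) (∋-⊙ P a p) }

  section-quotient : ∀ {n e} (A : Sub n e) v → ⟦ A ⟧ ∋ (v ⊕ ⊝ section A (quotient A v))
  section-quotient A v = trans (quotient-⊕ A _ _) (trans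
    (cong (quotient A v ⊕_) (trans (quotient-⊙ A (-F 1#) _) (cong ⊝_ (quotient-section A _)))) (⊕-inverseʳ _))

  /-lower : ∀ {n e} (A : Sub n e) (P : DecSubspace n) → ⟦ A ⟧ ⊑ P → ∀ v → P ∋ v → (P / A) ∋ quotient A v
  /-lower A P A⊑P v p = subst (P ∋_)
    (trans (cong (_⊕ ⊝ (v ⊕ ⊝ s)) (trans (sym (⊕-⊝-cancel v s)) (⊕-comm _ s))) (⊝-⊕-cancel s (v ⊕ ⊝ s)))
    (∋-⊕ P p (∋-⊝ P (A⊑P _ (section-quotient A v))))
    where s = section A (quotient A v)

  /-lift : ∀ {n e} (A : Sub n e) (P : DecSubspace n) → ⟦ A ⟧ ⊑ P → ∀ v → (P / A) ∋ quotient A v → P ∋ v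
  /-lift A P A⊑P v p = subst (P ∋_) (⊕-⊝-cancel v _) (∋-⊕ P (A⊑P _ (section-quotient A v)) p)

  -- The map (u , w) ↦ embed A u + section A w is a bijection from F^e × (P / A) onto P.
  dim-/ : ∀ {n e} (A : Sub n e) (P : DecSubspace n) → ⟦ A ⟧ ⊑ P → dim (P / A) + e ≡ dim P
  dim-/ {e = e} A P A⊑P = trans (ℕₚ.+-comm _ e) (sym (dim-unique P (subst (Card (P ∋_)) (sym (ℕₚ.^-distribˡ-+-* q e _))
    (card-map (λ (u , w) → embed A u ⊕ section A w)
      (λ (u , w) (_ , p) → ∋-⊕ P (A⊑P _ (quotient-embed A u)) p)
      (λ (u , w) (u′ , w′) eq → inj u w u′ w′ (trans (sym (project u w)) (trans (cong (quotient A) eq) (project u′ w′))) eq)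
      (λ v p → onto v p)
      (card-× (vectors e) (card-dim (P / A))))) (λ _ p → p) (λ _ p → p)))
    where
      project : ∀ u w → quotient A (embed A u ⊕ section A w) ≡ w
      project u w = trans (quotient-⊕ A _ _) (trans (cong₂ _⊕_ (quotient-embed A u) (quotient-section A w)) (⊕-identityˡ w))

      inj : ∀ u w u′ w′ → w ≡ w′ → embed A u ⊕ section A w ≡ embed A u′ ⊕ section A w′ → (u , w) ≡ (u′ , w′)
      inj u w u′ .w refl eq = cong (_, w) (embed-injective A u u′ (⊕-cancelʳ (section A w) _ _ eq))

      onto : ∀ v → P ∋ v → ∃ λ ((u , w) : Vec F _ × Vec F _) → (⊤ × (P / A) ∋ w) × embed A u ⊕ section A w ≡ v
      onto v p with embed-onto A (v ⊕ ⊝ section A (quotient A v)) (section-quotient A v)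
      ... | u , eq = (u , quotient A v) , (tt , /-lower A P A⊑P v p) , trans (cong (_⊕ section A (quotient A v)) eq) (⊕-⊝-cancel v _)

  -- The quotient by `A` lowers all dimensions by `e` and keeps members distinct. Truncation in
  -- `K a ∸ e` is harmless, since it can only increase the size and thus helps `large/`.
  intersection-bound-above : ∀ {n e} (A : Sub n e) s (L : Fin s → ℕ) r (K : Fin r → ℕ) m (W : Fin m → Code n)
    → (∀ i → ⟦ A ⟧ ⊑ ⟪ W i ⟫)
    → (∀ i j → W i ≡ W j → i ≡ j)
    → (∀ i j → i ≢ j → ∃ λ a → dim (⟪ W i ⟫ ⊓ ⟪ W j ⟫) ≡ L a + e)
    → (∀ i → ∃ λ a → dimension (W i) ≡ K a)
    → (∀ a → s + e < K a + r)
    → m ≤ bound q (n ∸ e) s r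
  intersection-bound-above {n} {e} A s L r K m W A⊑W W-inj meets sizes large =
    subst (λ c → m ≤ bound q c s r) (codim≡ A)
      (intersection-bound (codim A) s L r (λ a → K a ∸ e) m W/ W/-inj meets/ sizes/ large/)
    where
      W/ : Fin m → Code (codim A)
      W/ i = proj₁ (code (⟪ W i ⟫ / A))

      W/⊑ : ∀ i → ⟪ W/ i ⟫ ⊑ ⟪ W i ⟫ / A
      W/⊑ i = proj₁ (proj₂ (code (⟪ W i ⟫ / A)))

      ⊑W/ : ∀ i → ⟪ W i ⟫ / A ⊑ ⟪ W/ i ⟫
      ⊑W/ i = proj₂ (proj₂ (code (⟪ W i ⟫ / A)))

      W/-⊑ : ∀ i j → W/ i ≡ W/ j → ⟪ W i ⟫ ⊑ ⟪ W j ⟫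
      W/-⊑ i j eq v p = /-lift A ⟪ W j ⟫ (A⊑W j) v (W/⊑ j _ (subst (λ U → ⟪ U ⟫ ∋ quotient A v) eq (⊑W/ i _ (/-lower A ⟪ W i ⟫ (A⊑W i) v p))))

      W/-inj : ∀ i j → W/ i ≡ W/ j → i ≡ j
      W/-inj i j eq = W-inj i j (code-unique (W i) (W j) (W/-⊑ i j eq) (W/-⊑ j i (sym eq)))

      meets/ : ∀ i j → i ≢ j → ∃ λ a → dim (⟪ W/ i ⟫ ⊓ ⟪ W/ j ⟫) ≡ L a
      meets/ i j i≢j with meets i j i≢j
      ... | a , eq = a , ℕₚ.+-cancelʳ-≡ e _ _ (trans (cong (_+ e)
          (dim-cong {P = ⟪ W/ i ⟫ ⊓ ⟪ W/ j ⟫} {(⟪ W i ⟫ ⊓ ⟪ W j ⟫) / A}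
            (λ v (p , r) → W/⊑ i v p , W/⊑ j v r) (λ v (p , r) → ⊑W/ i v p , ⊑W/ j v r)))
        (trans (dim-/ A (⟪ W i ⟫ ⊓ ⟪ W j ⟫) (λ v p → A⊑W i v p , A⊑W j v p)) eq))

      sizes/ : ∀ i → ∃ λ a → dimension (W/ i) ≡ K a ∸ e
      sizes/ i with sizes i
      ... | a , eq = a , trans (sym (ℕₚ.m+n∸n≡m _ e))
        (cong (_∸ e) (trans (dim-/ A ⟪ W i ⟫ (A⊑W i)) (trans (dim-⟪⟫ (W i)) eq)))

      large/ : ∀ a → s < (K a ∸ e) + r
      large/ a = ℕₚ.+-cancelʳ-< e s _ (ℕₚ.<-≤-trans (large a) (ℕₚ.≤-trans (ℕₚ.+-monoˡ-≤ r (ℕₚ.m≤n+m∸n (K a) e))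
        (ℕₚ.≤-reflexive (rotate e (K a ∸ e) r))))
        where
          rotate : ∀ x y z → x + y + z ≡ y + z + x
          rotate = ℕ-Solver.solve-∀

  -- Subspaces T that meet every member

  -- Replacing a `new` step by `ext` intersects with the hyperplane where that coordinate is 0;
  -- outer `new` steps are dropped until dimension `e` is reached.
  smaller : ∀ {n d} (U : Sub n d) e → e ≤ d → Σ (Sub n e) λ E → ⟦ E ⟧ ⊑ ⟦ U ⟧
  smaller nil zero z≤n = nil , λ _ p → p
  smaller (ext U) e e≤d with smaller U e e≤d
  ... | E , E⊑U = ext E , λ { (x ∷ v) p → cong₂ _∷_ (Vecₚ.∷-injectiveˡ p) (E⊑U v (Vecₚ.∷-injectiveʳ p)) }
  smaller (new {d = d} U w) e e≤1+d with e ℕₚ.≟ suc d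
  ... | yes refl = new U w , λ _ p → p
  ... | no e≢1+d with smaller U e (ℕₚ.≤-pred (ℕₚ.≤∧≢⇒< e≤1+d e≢1+d))
  ...   | E , E⊑U = ext E , λ { (x ∷ v) p → trans (cong₂ _⊕_ (E⊑U v (Vecₚ.∷-injectiveʳ p))
            (trans (cong (_⊙ w) (Vecₚ.∷-injectiveˡ p)) (⊙-zeroˡ w))) (⊕-identityʳ 𝟘) }

  -- The intersection with `T` in the coordinates of `T`, so that subspaces of `T` are counted as
  -- subspaces of F^t.
  preimage : ∀ {n t} → Sub n t → DecSubspace n → DecSubspace t
  preimage T P = record
    { _∋_ = λ u → P ∋ embed T u ; _∋?_ = λ u → P ∋? embed T u ; ∋-𝟘 = subst (P ∋_) (sym (embed-𝟘 T)) (∋-𝟘 P)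
    ; ∋-⊕ = λ p r → subst (P ∋_) (sym (embed-⊕ T _ _)) (∋-⊕ P p r)
    ; ∋-⊙ = λ a p → subst (P ∋_) (sym (embed-⊙ T a _)) (∋-⊙ P a p) }

  image : ∀ {n t} → Sub n t → DecSubspace t → DecSubspace n
  image T P = record
    { _∋_ = λ v → ∃ λ u → P ∋ u × embed T u ≡ v
    ; _∋?_ = λ v → any-member? (vectors _) λ u → (P ∋? u) Decidable.×-dec (embed T u ≟V v)
    ; ∋-𝟘 = 𝟘 , ∋-𝟘 P , embed-𝟘 T
    ; ∋-⊕ = λ { (u , p , refl) (v , r , refl) → u ⊕ v , ∋-⊕ P p r , embed-⊕ T u v }
    ; ∋-⊙ = λ { a (u , p , refl) → a ⊙ u , ∋-⊙ P a p , embed-⊙ T a u } }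

  dim-preimage : ∀ {n t} (T : Sub n t) (P : DecSubspace n) → dim (preimage T P) ≡ dim (P ⊓ ⟦ T ⟧)
  dim-preimage T P = sym (dim-unique (P ⊓ ⟦ T ⟧)
    (card-map {Q = (P ⊓ ⟦ T ⟧) ∋_} (embed T) (λ u p → p , quotient-embed T u) (embed-injective T) onto (card-dim (preimage T P)))
    (λ _ p → p) (λ _ p → p))
    where
      onto : ∀ v → (P ⊓ ⟦ T ⟧) ∋ v → ∃ λ u → preimage T P ∋ u × embed T u ≡ v
      onto v (p , r) with embed-onto T v r
      ... | u , refl = u , p , refl

  dim-image : ∀ {n t} (T : Sub n t) (P : DecSubspace t) → dim (image T P) ≡ dim P
  dim-image T P = dim-unique (image T P)
    (card-map {Q = image T P ∋_} (embed T) (λ u p → u , p , refl) (embed-injective T) (λ v p → p) (card-dim P)) (λ _ p → p) (λ _ p → p)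

  code-of-dim : ∀ {n d} (P : DecSubspace n) → dim P ≡ d → Σ (Sub n d) λ U → ⟦ U ⟧ ⊑ P × P ⊑ ⟦ U ⟧
  code-of-dim P refl = proj₂ (proj₁ (code P)) , proj₂ (code P)

  -- Each member is assigned one `e`-dimensional subspace of its intersection with `T`; the members
  -- with a given value all contain that subspace, so every fibre has at most `B` elements.
  cover-bound : ∀ {n e m} B (T : Code n) (W : Fin m → Code n)
    → (∀ i → e ≤ dim (⟪ W i ⟫ ⊓ ⟪ T ⟫))
    → (∀ (A : Sub n e) m′ (g : Fin m′ → Fin m) → (∀ i j → g i ≡ g j → i ≡ j) → (∀ i → ⟦ A ⟧ ⊑ ⟪ W (g i) ⟫) → m′ ≤ B)
    → m ≤ #subspaces q (dimension T) e * B
  cover-bound {n} {e} {m} B (t , T) W large above = fiber-bound B (λ i → index (subs t e) (proj₁ (part i)) tt) small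
    where
      part : ∀ i → Σ (Sub t e) λ E → ⟦ E ⟧ ⊑ preimage T ⟪ W i ⟫
      part i with smaller (proj₂ (proj₁ (code (preimage T ⟪ W i ⟫)))) e (subst (e ≤_) (sym (dim-preimage T ⟪ W i ⟫)) (large i))
      ... | E , E⊑ = E , λ v p → proj₁ (proj₂ (code (preimage T ⟪ W i ⟫))) v (E⊑ v p)

      small : ∀ c {k} → Card (λ i → index (subs t e) (proj₁ (part i)) tt ≡ c) k → k ≤ B
      small c C with code-of-dim (image T ⟦ elem (subs t e) c ⟧) (trans (dim-image T _) (dim-⟪⟫ (e , elem (subs t e) c)))
      ... | A , A⊑ , _ = above A _ (elem C) (injective C) λ i v p → below i v (A⊑ v p)
        where
          same : ∀ i → elem (subs t e) c ≡ proj₁ (part (elem C i))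
          same i = trans (cong (elem (subs t e)) (sym (elem∈ C i))) (elem-index (subs t e) _ tt)

          below : ∀ i → image T ⟦ elem (subs t e) c ⟧ ⊑ ⟪ W (elem C i) ⟫
          below i v (u , p , refl) = proj₂ (part (elem C i)) u (subst (λ E → ⟦ E ⟧ ∋ u) (same i) p)

  n≤n*n : ∀ n → n ≤ n * n
  n≤n*n zero    = z≤n
  n≤n*n (suc n) = ℕₚ.m≤m*n (suc n) (suc n)

  -- The dimension formula is applied twice: P ∩ Q has dimension at least `l`, and so has (P + Q) ∩
  -- R, since it contains P ∩ R.
  triple-dim : ∀ {n l k} (P Q R : DecSubspace n) → l ≤ dim (P ⊓ Q) → l ≤ dim (P ⊓ R)
    → dim P ≤ k → dim Q ≤ k → dim R ≤ k → dim ((P ⊞ Q) ⊞ R) + (l + l) ≤ k + k + k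
  triple-dim {l = l} {k} P Q R lPQ lPR p≤ q≤ r≤ = begin
    dim ((P ⊞ Q) ⊞ R) + (l + l)          ≡⟨ sym (ℕₚ.+-assoc (dim ((P ⊞ Q) ⊞ R)) l l) ⟩
    dim ((P ⊞ Q) ⊞ R) + l + l            ≤⟨ ℕₚ.+-monoˡ-≤ l (ℕₚ.+-monoʳ-≤ (dim ((P ⊞ Q) ⊞ R)) (ℕₚ.≤-trans lPR
        (dim-mono {P = P ⊓ R} {(P ⊞ Q) ⊓ R} λ v (p , r) → ⊞-upperˡ P Q v p , r))) ⟩
    dim ((P ⊞ Q) ⊞ R) + dim ((P ⊞ Q) ⊓ R) + l ≤⟨ ℕₚ.+-monoˡ-≤ l (dim-⊞ (P ⊞ Q) R) ⟩
    dim (P ⊞ Q) + dim R + l              ≡⟨ swap (dim (P ⊞ Q)) (dim R) l ⟩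
    dim (P ⊞ Q) + l + dim R              ≤⟨ ℕₚ.+-mono-≤ (ℕₚ.≤-trans (ℕₚ.+-monoʳ-≤ (dim (P ⊞ Q)) lPQ) (dim-⊞ P Q)) r≤ ⟩
    dim P + dim Q + k                    ≤⟨ ℕₚ.+-monoˡ-≤ k (ℕₚ.+-mono-≤ p≤ q≤) ⟩
    k + k + k ∎
    where
      open ℕₚ.≤-Reasoning
      swap : ∀ x y z → x + y + z ≡ x + z + y
      swap = ℕ-Solver.solve-∀

  -- Here d ≤ 3k - 2, and k^2 - 3k + 2 = (k - 1)(k - 2) is never negative.
  square-bound : ∀ {d l k} → 1 ≤ l → d + (l + l) ≤ k + k + k → d ≤ k * k
  square-bound {d} {l} {k} 1≤l h = ℕₚ.+-cancelʳ-≤ 2 d (k * k) (ℕₚ.≤-trans (ℕₚ.+-monoʳ-≤ d (ℕₚ.+-mono-≤ 1≤l 1≤l)) (ℕₚ.≤-trans h (convex k)))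
    where
      convex : ∀ k → k + k + k ≤ k * k + 2
      convex zero    = z≤n
      convex (suc k) = subst₂ _≤_ (sym (lhs k)) (sym (rhs k)) (ℕₚ.+-monoˡ-≤ (k + k + 3) (n≤n*n k))
        where
          lhs : ∀ k → suc k + suc k + suc k ≡ k + (k + k + 3)
          lhs = ℕ-Solver.solve-∀
          rhs : ∀ k → suc k * suc k + 2 ≡ k * k + (k + k + 3)
          rhs = ℕ-Solver.solve-∀

  -- If X ∩ T had dimension at most l, where T = P + Q + R, then X ∩ P, X ∩ Q and X ∩ R would all
  -- be X ∩ T; so X ∩ T = P ∩ Q would lie in R.
  triple-meets : ∀ {n l} (P Q R X : DecSubspace n) → dim (P ⊓ Q) ≡ l → ¬ (P ⊓ Q) ⊑ R
    → l ≤ dim (X ⊓ P) → l ≤ dim (X ⊓ Q) → l ≤ dim (X ⊓ R) → suc l ≤ dim (X ⊓ ((P ⊞ Q) ⊞ R))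
  triple-meets {l = l} P Q R X PQ≡l PQ⋢R lP lQ lR with suc l ℕₚ.≤? dim (X ⊓ ((P ⊞ Q) ⊞ R))
  ... | yes le = le
  ... | no ¬le = contradiction PQ⊑R PQ⋢R
    where
      T = (P ⊞ Q) ⊞ R

      T≤l : dim (X ⊓ T) ≤ l
      T≤l = ℕₚ.≤-pred (ℕₚ.≰⇒> ¬le)

      confined : ∀ Y → Y ⊑ T → l ≤ dim (X ⊓ Y) → X ⊓ T ⊑ Y
      confined Y Y⊑T lY v p = proj₂ (⊑-by-dim {P = X ⊓ Y} {X ⊓ T} (λ v (x , y) → x , Y⊑T v y) (ℕₚ.≤-trans T≤l lY) v p)

      P⊑T : P ⊑ T
      P⊑T v p = ⊞-upperˡ (P ⊞ Q) R v (⊞-upperˡ P Q v p)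

      Q⊑T : Q ⊑ T
      Q⊑T v p = ⊞-upperˡ (P ⊞ Q) R v (⊞-upperʳ P Q v p)

      R⊑T : R ⊑ T
      R⊑T = ⊞-upperʳ (P ⊞ Q) R

      PQ⊑XT : P ⊓ Q ⊑ X ⊓ T
      PQ⊑XT = ⊑-by-dim {P = X ⊓ T} {P ⊓ Q} (λ v p → confined P P⊑T lP v p , confined Q Q⊑T lQ v p)
        (ℕₚ.≤-trans (ℕₚ.≤-reflexive PQ≡l) (ℕₚ.≤-trans lP (dim-mono {P = X ⊓ P} {X ⊓ T} λ v (x , p) → x , P⊑T v p)))

      PQ⊑R : P ⊓ Q ⊑ R
      PQ⊑R v p = confined R R⊑T lR v (PQ⊑XT v p)

  -- The bound for a family of codes

  module _ {n t} (L : Fin (suc t) → ℕ) (L-mono : ∀ a b → a Fin.< b → L a < L b)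
           {r} (K : Fin r → ℕ) {m} (W : Fin m → Code n) (W-inj : ∀ i j → W i ≡ W j → i ≡ j)
           (meets : ∀ i j → i ≢ j → ∃ λ a → dim (⟪ W i ⟫ ⊓ ⟪ W j ⟫) ≡ L a)
           (sizes : ∀ i → ∃ λ a → dimension (W i) ≡ K a)
           (large : ∀ a → suc t + L Fin.zero < K a + r) where

    private
      l : ℕ
      l = L Fin.zero

    l≤L : ∀ a → l ≤ L a
    l≤L Fin.zero    = ℕₚ.≤-refl
    l≤L (Fin.suc a) = ℕₚ.<⇒≤ (L-mono Fin.zero (Fin.suc a) (s≤s z≤n))

    -- Distinct members meet in dimension at least `l`, so a member of dimension below `l` is alone.
    -- Its size K a < l turns `large` into s < r, which makes the bound positive.
    small-member-bound : ∀ i → dimension (W i) < l → m ≤ bound q (n ∸ l) (suc t) r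
    small-member-bound i d<l = ℕₚ.≤-trans (Finₚ.injective⇒≤ {f = λ (_ : Fin m) → Fin.zero {0}} λ {j} {k} _ → trans (only j) (sym (only k)))
        (bound>0 2≤q (n ∸ l) (suc t) r t<r)
      where
        only : ∀ j → j ≡ i
        only j with j Finₚ.≟ i
        ... | yes eq = eq
        ... | no j≢i with meets j i j≢i
        ...   | a , eq = contradiction d<l (ℕₚ.≤⇒≯ (ℕₚ.≤-trans (l≤L a) (ℕₚ.≤-trans (ℕₚ.≤-reflexive (sym eq))
                  (subst (dim (⟪ W j ⟫ ⊓ ⟪ W i ⟫) ≤_) (dim-⟪⟫ (W i)) (dim-mono {P = ⟪ W j ⟫ ⊓ ⟪ W i ⟫} {⟪ W i ⟫} λ _ → proj₂)))))

        t<r : suc t < r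
        t<r with sizes i
        ... | a , eq = ℕₚ.+-cancelʳ-< l (suc t) r (ℕₚ.<-trans (large a)
              (subst (_< r + l) (ℕₚ.+-comm r (K a)) (ℕₚ.+-monoʳ-< r (subst (_< l) eq d<l))))

    common-core-bound : (A : Sub n l) → (∀ i → ⟦ A ⟧ ⊑ ⟪ W i ⟫) → m ≤ bound q (n ∸ l) (suc t) r
    common-core-bound A A⊑W = intersection-bound-above A (suc t) (λ a → L a ∸ l) r K m W A⊑W W-inj
      (λ i j i≢j → proj₁ (meets i j i≢j) , trans (proj₂ (meets i j i≢j)) (sym (ℕₚ.m∸n+n≡m (l≤L _)))) sizes large

    -- Intersections contain `A`, which rules out the value `l` and leaves t = s - 1 values. The
    -- condition on the sizes carries over because t + (l + 1) = (t + 1) + l.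
    containing-bound : (A : Sub n (suc l)) → ∀ m′ (g : Fin m′ → Fin m) → (∀ i j → g i ≡ g j → i ≡ j)
      → (∀ i → ⟦ A ⟧ ⊑ ⟪ W (g i) ⟫) → m′ ≤ bound q (n ∸ suc l) t r
    containing-bound A m′ g g-inj A⊑W = intersection-bound-above A t (λ a → L (Fin.suc a) ∸ suc l) r K m′ (λ i → W (g i)) A⊑W
        (λ i j eq → g-inj i j (W-inj _ _ eq)) meets′ (λ i → sizes (g i)) (λ a → subst (_< K a + r) (sym (ℕₚ.+-suc t l)) (large a))
      where
        meets′ : ∀ i j → i ≢ j → ∃ λ a → dim (⟪ W (g i) ⟫ ⊓ ⟪ W (g j) ⟫) ≡ L (Fin.suc a) ∸ suc l + suc l
        meets′ i j i≢j with meets (g i) (g j) (λ eq → i≢j (g-inj i j eq))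
        ... | Fin.suc a , eq = a , trans eq (sym (ℕₚ.m∸n+n≡m (L-mono Fin.zero (Fin.suc a) (s≤s z≤n))))
        ... | Fin.zero , eq = contradiction (subst₂ _≤_ (dim-⟪⟫ (_ , A)) eq
                (dim-mono {P = ⟦ A ⟧} {⟪ W (g i) ⟫ ⊓ ⟪ W (g j) ⟫} λ v p → A⊑W i v p , A⊑W j v p)) (ℕₚ.1+n≰n)

    transversal-bound : ∀ {k} (T : Code n) → dimension T ≤ k * k → (∀ i → suc l ≤ dim (⟪ W i ⟫ ⊓ ⟪ T ⟫))
      → (q ^ suc t ∸ 1) * gauss q (k * k) (l + 1) + 1 ≤ q ^ (n ∸ l) → m ≤ bound q (n ∸ l) (suc t) r
    transversal-bound {k} T T≤ T-meets h = begin
      m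
        ≤⟨ cover-bound (bound q (n ∸ suc l) t r) T W T-meets containing-bound ⟩
      #subspaces q (dimension T) (suc l) * bound q (n ∸ suc l) t r
        ≤⟨ ℕₚ.*-monoˡ-≤ _ (#subspaces-mono q (suc l) T≤) ⟩
      #subspaces q (k * k) (suc l) * bound q (n ∸ suc l) t r
        ≡⟨ cong₂ (λ x y → x * bound q y t r) (trans (sym (gauss≡#subspaces 2≤q (k * k) (suc l))) (cong (gauss q (k * k)) (ℕₚ.+-comm 1 l)))
                 (trans (cong (n ∸_) (ℕₚ.+-comm 1 l)) (sym (ℕₚ.∸-+-assoc n l 1))) ⟩
      gauss q (k * k) (l + 1) * bound q (n ∸ l ∸ 1) t r
        ≤⟨ bound-multiply 2≤q _ (n ∸ l) t r h ⟩
      bound q (n ∸ l) (suc t) r ∎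
      where open ℕₚ.≤-Reasoning

    family-bound : ∀ k → (∀ i → dimension (W i) ≤ k)
      → (q ^ suc t ∸ 1) * gauss q (k * k) (l + 1) + 1 ≤ q ^ (n ∸ l) → m ≤ bound q (n ∸ l) (suc t) r
    family-bound k W≤k h with Finₚ.any? (λ i → dimension (W i) ℕₚ.<? l)
    ... | yes (i , d<l) = small-member-bound i d<l
    ... | no ¬small with any-member? (subs n l) (λ A → Finₚ.all? λ i → ⟦ A ⟧ ⊑? ⟪ W i ⟫)
    ...   | yes (A , A⊑W) = common-core-bound A A⊑W
    ...   | no ¬core = cases m refl (Finₚ.any? λ i → Finₚ.any? λ j → dim (⟪ W i ⟫ ⊓ ⟪ W j ⟫) ℕₚ.≟ l)
      where
        -- For l = 0 the zero subspace would be a common core.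
        1≤l : 1 ≤ l
        1≤l = ℕₚ.n≢0⇒n>0 λ l≡0 → ¬core (subst (Sub n) (sym l≡0) (zero-sub n) , λ i → below l l≡0 ⟪ W i ⟫)
          where
            below : ∀ l (eq : l ≡ 0) (P : DecSubspace n) → ⟦ subst (Sub n) (sym eq) (zero-sub n) ⟧ ⊑ P
            below .0 refl P = zero-sub-least P

        -- The case i = j is included because `triple-meets` is applied to every member, also to the
        -- three that span `T`.
        l≤meet : ∀ i j → l ≤ dim (⟪ W i ⟫ ⊓ ⟪ W j ⟫)
        l≤meet i j with i Finₚ.≟ j
        ... | no i≢j = subst (l ≤_) (sym (proj₂ (meets i j i≢j))) (l≤L _)
        ... | yes refl = ℕₚ.≤-trans (ℕₚ.≮⇒≥ λ d<l → ¬small (i , d<l)) (subst (_≤ dim (⟪ W i ⟫ ⊓ ⟪ W i ⟫)) (dim-⟪⟫ (W i))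
                (dim-mono {P = ⟪ W i ⟫} {⟪ W i ⟫ ⊓ ⟪ W i ⟫} λ _ p → p , p))

        dim≤k : ∀ i → dim ⟪ W i ⟫ ≤ k
        dim≤k i = subst (_≤ k) (sym (dim-⟪⟫ (W i))) (W≤k i)

        Goal : Set
        Goal = m ≤ bound q (n ∸ l) (suc t) r

        -- The equation allows a split on `m`, on which `W` depends; a nonempty family supplies
        -- `Fin.zero`.
        cases : ∀ m′ → m′ ≡ m → Dec (∃ λ i → ∃ λ j → dim (⟪ W i ⟫ ⊓ ⟪ W j ⟫) ≡ l) → Goal
        cases zero    refl _ = z≤n
        -- The search also covered i = j, so the first member meets every member, itself included,
        -- in dimension above `l`.
        cases (suc _) refl (no none) = transversal-bound {k} T (ℕₚ.≤-trans (W≤k Fin.zero) (n≤n*n k))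
            (λ i → ℕₚ.≤∧≢⇒< (l≤meet i Fin.zero) (λ eq → none (i , Fin.zero , sym eq))) h
          where
            T = W Fin.zero
        -- The indices may coincide, which means a member of dimension `l`; the argument is the
        -- same.
        cases (suc _) refl (yes (i , j , eq)) with code-of-dim (⟪ W i ⟫ ⊓ ⟪ W j ⟫) eq
        ... | A , A⊑ , ⊑A with Finₚ.¬∀⟶∃¬ _ (λ k → ⟦ A ⟧ ⊑ ⟪ W k ⟫) (λ k → ⟦ A ⟧ ⊑? ⟪ W k ⟫) (λ A⊑W → ¬core (A , A⊑W))
        ...   | h′ , A⋢Wh = transversal-bound {k} (proj₁ (code T))
                  (square-bound {k = k} 1≤l (triple-dim ⟪ W i ⟫ ⟪ W j ⟫ ⟪ W h′ ⟫ (l≤meet i j) (l≤meet i h′) (dim≤k i) (dim≤k j) (dim≤k h′)))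
                  (λ x → ℕₚ.≤-trans
                    (triple-meets ⟪ W i ⟫ ⟪ W j ⟫ ⟪ W h′ ⟫ ⟪ W x ⟫ eq (λ below → A⋢Wh λ v p → below v (A⊑ v p)) (l≤meet x i) (l≤meet x j) (l≤meet x h′))
                    (dim-mono {P = ⟪ W x ⟫ ⊓ T} {⟪ W x ⟫ ⊓ ⟪ proj₁ (code T) ⟫} λ v (x , y) → x , proj₂ (proj₂ (code T)) v y))
                  h
          where
            T = (⟪ W i ⟫ ⊞ ⟪ W j ⟫) ⊞ ⟪ W h′ ⟫

  -- From bases to cardinalities, and the theorem

  lincomb-cong : ∀ {n d} {c c′ : Fin d → F} (b : Fin d → Vec F n) → (∀ i → c i ≡ c′ i) → lincomb 𝔽 n c b ≡ lincomb 𝔽 n c′ b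
  lincomb-cong {d = zero}  b eq = refl
  lincomb-cong {d = suc d} b eq = cong₂ _⊕_ (cong (_⊙ b Fin.zero) (eq Fin.zero)) (lincomb-cong (λ i → b (Fin.suc i)) (λ i → eq (Fin.suc i)))

  lincomb-⊝ : ∀ {n d} (c c′ : Fin d → F) (b : Fin d → Vec F n)
    → lincomb 𝔽 n (λ i → c i +F (-F c′ i)) b ≡ lincomb 𝔽 n c b ⊕ ⊝ lincomb 𝔽 n c′ b
  lincomb-⊝ {d = zero}  c c′ b = sym (⊕-inverseʳ 𝟘)
  lincomb-⊝ {n} {suc d} c c′ b = trans (cong₂ _⊕_
      (trans (⊙-distribʳ _ _ _) (cong (c Fin.zero ⊙ b Fin.zero ⊕_) (neg-⊙ (c′ Fin.zero) (b Fin.zero))))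
      (lincomb-⊝ (λ i → c (Fin.suc i)) (λ i → c′ (Fin.suc i)) (λ i → b (Fin.suc i))))
    (trans (⊕-interchange (c Fin.zero ⊙ b Fin.zero) (⊝ (c′ Fin.zero ⊙ b Fin.zero)) rest (⊝ rest′))
      (cong (c Fin.zero ⊙ b Fin.zero ⊕ rest ⊕_) (sym (⊙-distribˡ (-F 1#) (c′ Fin.zero ⊙ b Fin.zero) rest′))))
    where
      rest rest′ : Vec F n
      rest  = lincomb 𝔽 n (λ i → c (Fin.suc i)) (λ i → b (Fin.suc i))
      rest′ = lincomb 𝔽 n (λ i → c′ (Fin.suc i)) (λ i → b (Fin.suc i))

  lincomb-closed : ∀ {n d} {P : Vec F n → Set} → P 𝟘 → (∀ u v → P u → P v → P (u ⊕ v)) → (∀ a v → P v → P (a ⊙ v))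
    → (c : Fin d → F) (b : Fin d → Vec F n) → (∀ i → P (b i)) → P (lincomb 𝔽 n c b)
  lincomb-closed {d = zero}  P𝟘 P⊕ P⊙ c b Pb = P𝟘
  lincomb-closed {d = suc d} P𝟘 P⊕ P⊙ c b Pb = P⊕ _ _ (P⊙ _ _ (Pb Fin.zero))
    (lincomb-closed P𝟘 P⊕ P⊙ (λ i → c (Fin.suc i)) (λ i → b (Fin.suc i)) (λ i → Pb (Fin.suc i)))

  -- Independence makes the map from coefficient vectors injective, spanning makes it onto. The
  -- statement is about bare predicates because `_∩_` yields a predicate and not a `Subspace`.
  card-HasDim : ∀ {n d} {P : Vec F n → Set} → P 𝟘 → (∀ u v → P u → P v → P (u ⊕ v)) → (∀ a v → P v → P (a ⊙ v))
    → HasDim 𝔽 n P d → Card P (q ^ d)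
  card-HasDim {n} {d} {P} P𝟘 P⊕ P⊙ (b , b∈ , independent , spanning) =
    card-map combination (λ c _ → lincomb-closed P𝟘 P⊕ P⊙ (lookup c) b b∈) combination-injective combination-onto (vectors d)
    where
      open GroupProperties (CommutativeRing.+-group F-ring) using (x∙y⁻¹≈ε⇒x≈y)

      combination : Vec F d → Vec F n
      combination c = lincomb 𝔽 n (lookup c) b

      combination-injective : ∀ c c′ → combination c ≡ combination c′ → c ≡ c′
      combination-injective c c′ eq = trans (sym (Vecₚ.tabulate∘lookup c)) (trans (Vecₚ.tabulate-cong λ i → x∙y⁻¹≈ε⇒x≈y _ _ (independent (λ i → lookup c i +F (-F lookup c′ i))
        (trans (lincomb-⊝ (lookup c) (lookup c′) b) (trans (cong (λ z → combination c ⊕ ⊝ z) (sym eq)) (⊕-inverseʳ _))) i)) (Vecₚ.tabulate∘lookup c′))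

      combination-onto : ∀ v → P v → ∃ λ c → ⊤ × combination c ≡ v
      combination-onto v p with spanning v p
      ... | c , eq = tabulate c , tt , trans (lincomb-cong b (Vecₚ.lookup∘tabulate c)) (sym eq)

  decSubspace : ∀ {n d} (V : Subspace 𝔽 n) → HasDim 𝔽 n (mem V) d → DecSubspace n
  decSubspace V V-dim = record
    { _∋_ = mem V
    ; _∋?_ = card-dec _≟V_ (card-HasDim (mem-zero V) (mem-+ V) (mem-· V) V-dim) (subst (mem V))
    ; ∋-𝟘 = mem-zero V ; ∋-⊕ = mem-+ V _ _ ; ∋-⊙ = λ a → mem-· V a _ }

maxF-upper : ∀ {m} (f : Fin m → ℕ) i → f i ≤ maxF f
maxF-upper f Fin.zero    = ℕₚ.m≤m⊔n _ _
maxF-upper f (Fin.suc i) = ℕₚ.≤-trans (maxF-upper (λ i → f (Fin.suc i)) i) (ℕₚ.m≤n⊔m (f Fin.zero) _)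

-- The difference s - r may be negative; adding r to both sides gives an inequality of natural
-- numbers free of truncated subtraction.
move-subtrahend : ∀ {s r l k} → ((+ s) -ℤ (+ r)) +ℤ (+ l) <ℤ + k → s + l < k + r
move-subtrahend {s} {r} {l} {k} lt = ℤₚ.drop‿+<+ (subst (_<ℤ + (k + r)) (rearrange (+ s) (+ r) (+ l)) (ℤₚ.+-monoˡ-< (+ r) lt))
  where
    rearrange : ∀ s r l → ((s -ℤ r) +ℤ l) +ℤ r ≡ s +ℤ l
    rearrange = ℤ-Solver.solve-∀

theorem1p16 : (q : ℕ) (𝔽 : FiniteField q) (n t : ℕ) (L : Fin (suc t) → ℕ)
    → (∀ a b → a Fin.< b → L a < L b)
    → (r : ℕ) (K : Fin r → ℕ) → Injective _≡_ _≡_ K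
    → (m : ℕ) (V : Fin m → Subspace 𝔽 n) (dim : Fin m → ℕ)
    → (∀ i → HasDim 𝔽 n (mem (V i)) (dim i))
    → (∀ i j → i ≢ j → ¬ SameSubspace 𝔽 n (V i) (V j))
    → (∀ i j → i ≢ j → ∃ λ d → HasDim 𝔽 n (_∩_ 𝔽 n (V i) (V j)) d × ∃ λ a → d ≡ L a)
    → (∀ j → ∃ λ a → dim j ≡ K a)
    → (∀ a → ((+ suc t) -ℤ (+ r)) +ℤ (+ L Fin.zero) <ℤ + K a)
    → L Fin.zero ≤ n
    → ((q ^ suc t) ∸ 1) * gauss q (maxF dim * maxF dim) (L Fin.zero + 1) + 1 ≤ q ^ (n ∸ L Fin.zero)
    → m ≤ bound q (n ∸ L Fin.zero) (suc t) r
theorem1p16 q 𝔽 n t L L-mono r K _ m V dimV V-dim distinct meets sizes large _ n-large =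
  family-bound L L-mono K W W-inj W-meets W-sizes (λ a → move-subtrahend (large a)) (maxF dimV)
    (λ i → ℕₚ.≤-trans (ℕₚ.≤-reflexive (W-dim i)) (maxF-upper dimV i)) n-large
  where
    open SubspaceFamilies 𝔽

    P : Fin m → DecSubspace n
    P i = decSubspace (V i) (V-dim i)

    W : Fin m → Code n
    W i = proj₁ (code (P i))

    W⊑P : ∀ i → ⟪ W i ⟫ ⊑ P i
    W⊑P i = proj₁ (proj₂ (code (P i)))

    P⊑W : ∀ i → P i ⊑ ⟪ W i ⟫
    P⊑W i = proj₂ (proj₂ (code (P i)))

    W-inj : ∀ i j → W i ≡ W j → i ≡ j
    W-inj i j eq with i Finₚ.≟ j
    ... | yes i≡j = i≡j
    ... | no i≢j = contradiction (λ v → transfer i j eq v , transfer j i (sym eq) v) (distinct i j i≢j)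
      where
        transfer : ∀ i j → W i ≡ W j → P i ⊑ P j
        transfer i j eq v p = W⊑P j v (subst (λ U → DecSubspace._∋_ ⟪ U ⟫ v) eq (P⊑W i v p))

    W-dim : ∀ i → dimension (W i) ≡ dimV i
    W-dim i = dim-unique (P i) (card-HasDim (mem-zero (V i)) (mem-+ (V i)) (mem-· (V i)) (V-dim i)) (λ _ p → p) (λ _ p → p)

    W-meets : ∀ i j → i ≢ j → ∃ λ a → dim (⟪ W i ⟫ ⊓ ⟪ W j ⟫) ≡ L a
    W-meets i j i≢j with meets i j i≢j
    ... | d , d-dim , a , d≡La = a , trans (dim-unique (⟪ W i ⟫ ⊓ ⟪ W j ⟫)
          (card-HasDim (mem-zero (V i) , mem-zero (V j))
            (λ u v (p , p′) (r , r′) → mem-+ (V i) u v p r , mem-+ (V j) u v p′ r′)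
            (λ a v (p , p′) → mem-· (V i) a v p , mem-· (V j) a v p′) d-dim)
          (λ v (p , r) → W⊑P i v p , W⊑P j v r) (λ v (p , r) → P⊑W i v p , P⊑W j v r)) d≡La

    W-sizes : ∀ i → ∃ λ a → dimension (W i) ≡ K a
    W-sizes i = proj₁ (sizes i) , trans (W-dim i) (proj₂ (sizes i))
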